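{- Every ($2K_2$, diamond)-free graph $G$ on $n$ vertices is recolorable, and the diameter of $R_\ell(G)$ is at most $2n^2$ for all $\ell\ge\chi(G)+1$.
   Context: All graphs are finite and simple. A $k$-coloring of $G$ is a map $V(G)\to\{1,\dots,k\}$ giving adjacent vertices different values; $\chi(G)$ is the chromatic number. $R_k(G)$ denotes the graph whose vertices are the $k$-colorings of $G$, two being adjacent if they differ in color on exactly one vertex. $G$ is recolorable if $R_\ell(G)$ is connected for all $\ell\ge\chi(G)+1$. A graph is $(H_1,H_2)$-free if it has no induced subgraph isomorphic to $H_1$ or $H_2$. $2K_2$ is the disjoint union of two edges; the diamond is $K_4$ minus an edge. -}

module Defs where

open import Data.Empty using (⊥-elim-irr)
open import Data.Nat using (ℕ; zero; suc; _+_; _≤_; z≤n; s≤s)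
open import Data.Fin using (Fin; zero; suc)
open import Data.Fin.Properties using (any?; all?; _≟_)
open import Data.Product using (∃; ∃-syntax; ∃₂; _×_; _,_; proj₁; proj₂; swap)
open import Data.Sum as Sum using (_⊎_; inj₁; inj₂)
open import Data.Sum.Relation.Binary.Pointwise as ⊎ using (Pointwise; ⊎-symmetric; ⊎-decidable)
open import Data.Vec using (Vec; []; _∷_; lookup; allFin)
open import Data.Vec.Properties using (lookup-allFin)
open import Function using (_∘_)
open import Function.Bundles using (_⇔_)
open import Function.Definitions using (Injective)
open import Relation.Binary.Construct.Closure.ReflexiveTransitive using (Star; ε; _◅_)
open import Relation.Binary.Definitions using (Decidable; Symmetric)
open import Relation.Binary.PropositionalEquality
  using (_≡_; _≢_; refl; sym; trans; ≢-sym)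
open import Relation.Nullary using (¬_; Dec; yes; no; contradiction)
open import Relation.Nullary.Decidable using (map′; ¬?; _×-dec_; _⊎-dec_; _→-dec_)
import Relation.Unary as U

record Graph (V : Set) : Set₁ where
  field
    Adj        : V → V → Set
    adj?       : Decidable Adj
    adj-sym    : Symmetric Adj
    adj-irrefl : ∀ v → ¬ Adj v v

open Graph public

complete : ∀ n → Graph (Fin n)
complete n = record
  { Adj        = _≢_
  ; adj?       = λ u v → ¬? (u ≟ v)
  ; adj-sym    = ≢-sym
  ; adj-irrefl = λ v v≢v → v≢v refl
  }

disjointUnion : {V W : Set} → Graph V → Graph W → Graph (V ⊎ W)
disjointUnion G H = record
  { Adj        = Pointwise (Adj G) (Adj H)
  ; adj?       = ⊎-decidable (adj? G) (adj? H)
  ; adj-sym    = ⊎-symmetric (adj-sym G) (adj-sym H)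
  ; adj-irrefl = λ where
      (inj₁ v) (⊎.inj₁ a) → adj-irrefl G v a
      (inj₂ w) (⊎.inj₂ a) → adj-irrefl H w a
  }

deleteEdge : ∀ {n} → Graph (Fin n) → Fin n → Fin n → Graph (Fin n)
deleteEdge G a b = record
  { Adj        = λ u v → Adj G u v × ¬ (u ≡ a × v ≡ b ⊎ u ≡ b × v ≡ a)
  ; adj?       = λ u v → adj? G u v
                   ×-dec ¬? ((u ≟ a ×-dec v ≟ b) ⊎-dec (u ≟ b ×-dec v ≟ a))
  ; adj-sym    = λ (e , ≢ab) →
                   adj-sym G e , ≢ab ∘ Sum.swap ∘ Sum.map swap swap
  ; adj-irrefl = λ v (e , _) → adj-irrefl G v e
  }

2K₂ : Graph (Fin 2 ⊎ Fin 2)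
2K₂ = disjointUnion (complete 2) (complete 2)

diamond : Graph (Fin 4)
diamond = deleteEdge (complete 4) zero (suc zero)

-- An isomorphism from H onto the subgraph of G induced by the image of embed.
record InducedCopy {W V : Set} (H : Graph W) (G : Graph V) : Set where
  field
    embed           : W → V
    embed-injective : Injective _≡_ _≡_ embed
    embed-adj       : ∀ x y → Adj H x y ⇔ Adj G (embed x) (embed y)

Free : {W₁ W₂ V : Set} → Graph W₁ → Graph W₂ → Graph V → Set
Free H₁ H₂ G = ¬ InducedCopy H₁ G × ¬ InducedCopy H₂ G

Walk : {V : Set} → Graph V → V → V → Set
Walk G = Star (Adj G)

walkLength : {V : Set} (G : Graph V) {u v : V} → Walk G u v → ℕ
walkLength G ε       = 0
walkLength G (_ ◅ w) = suc (walkLength G w)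

Connected : {V : Set} → Graph V → Set
Connected G = ∀ u v → Walk G u v

IsDistance : {V : Set} → Graph V → V → V → ℕ → Set
IsDistance G u v d =
  (∃[ w ] walkLength G {u} {v} w ≡ d) × (∀ (w : Walk G u v) → d ≤ walkLength G w)

-- All distances are finite and D is the largest of them.
IsDiameter : {V : Set} → Graph V → ℕ → Set
IsDiameter G D =
    (∀ u v → ∃[ d ] IsDistance G u v d × d ≤ D)
  × (∃₂ λ u v → IsDistance G u v D)

Proper : ∀ {n k} → Graph (Fin n) → Vec (Fin k) n → Set
Proper G c = ∀ u v → Adj G u v → lookup c u ≢ lookup c v

-- Colour vectors and an irrelevant properness proof make propositional
-- equality of colorings the same as having equal colours at every vertex.
record Coloring {n : ℕ} (G : Graph (Fin n)) (k : ℕ) : Set where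
  constructor coloring
  field
    colors  : Vec (Fin k) n
    .proper : Proper G colors

  color : Fin n → Fin k
  color = lookup colors

open Coloring public using (colors; color)

Colorable : ∀ {n} → Graph (Fin n) → ℕ → Set
Colorable G k = Coloring G k

IsChromaticNumber : ∀ {n} → Graph (Fin n) → ℕ → Set
IsChromaticNumber G k = Colorable G k × (∀ j → Colorable G j → k ≤ j)

anyVec? : ∀ {k} n {P : Vec (Fin k) n → Set} → U.Decidable P → Dec (∃ P)
anyVec? zero    P? = map′ (λ p → [] , p) (λ where ([] , p) → p) (P? [])
anyVec? (suc n) P? =
  map′ (λ (x , c , p) → x ∷ c , p) (λ where (x ∷ c , p) → x , c , p)
       (any? λ x → anyVec? n λ c → P? (x ∷ c))

proper? : ∀ {n k} (G : Graph (Fin n)) → U.Decidable (Proper {k = k} G)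
proper? G c =
  all? λ u → all? λ v → adj? G u v →-dec ¬? (lookup c u ≟ lookup c v)

colorable? : ∀ {n} (G : Graph (Fin n)) → U.Decidable (Colorable G)
colorable? {n} G k =
  map′ (λ (c , p) → coloring c p)
       (λ (coloring c p) → c , λ u v e eq → ⊥-elim-irr (p u v e eq))
       (anyVec? n (proper? G))

least : {P : ℕ → Set} → U.Decidable P → ∀ m → P m →
        ∃[ k ] P k × (∀ j → P j → k ≤ j)
least P? zero    p = zero , p , λ _ _ → z≤n
least P? (suc m) p with P? zero
... | yes p₀ = zero , p₀ , λ _ _ → z≤n
... | no ¬p₀ with least (P? ∘ suc) m p
...   | k , pk , min = suc k , pk , λ where
        zero    p₀ → contradiction p₀ ¬p₀
        (suc j) pj → s≤s (min j pj)

chromatic : ∀ {n} (G : Graph (Fin n)) → ∃ (IsChromaticNumber G)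
chromatic {n} G = least (colorable? G) n (coloring (allFin n) distinct)
  where
  distinct : Proper G (allFin n)
  distinct u v e eq
    with refl ← trans (sym (lookup-allFin u)) (trans eq (lookup-allFin v))
    = adj-irrefl G u e

χ : ∀ {n} → Graph (Fin n) → ℕ
χ G = proj₁ (chromatic G)

χ-isChromaticNumber : ∀ {n} (G : Graph (Fin n)) → IsChromaticNumber G (χ G)
χ-isChromaticNumber G = proj₂ (chromatic G)

DifferAtExactlyOne : ∀ {n k} {G : Graph (Fin n)} → Coloring G k → Coloring G k → Set
DifferAtExactlyOne c d =
  ∃[ v ] color c v ≢ color d v × (∀ u → u ≢ v → color c u ≡ color d u)

R : ∀ {n} (k : ℕ) (G : Graph (Fin n)) → Graph (Coloring G k)
R k G = record
  { Adj        = DifferAtExactlyOne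
  ; adj?       = λ c d → any? λ v →
                   ¬? (color c v ≟ color d v)
                   ×-dec all? λ u → ¬? (u ≟ v) →-dec (color c u ≟ color d u)
  ; adj-sym    = λ (v , c≢d , same) → v , ≢-sym c≢d , λ u u≢v → sym (same u u≢v)
  ; adj-irrefl = λ c (v , c≢c , _) → c≢c refl
  }

Recolorable : ∀ {n} → Graph (Fin n) → Set
Recolorable G = ∀ ℓ → χ G + 1 ≤ ℓ → Connected (R ℓ G)

module Submission where

-- Two proper colourings c, d with c u ≢ d v for every edge uv are at distance at
-- most n: change c into d vertex by vertex, in any order.  So it suffices to join
-- any two ℓ-colourings by 2n such jumps.  If N(u) ⊆ N(v), then u can copy v once
-- and mimic it from then on, so u may be deleted at the price of two jumps.
-- When no such pair is left, G is complete or one of the circulants C₅(1),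
-- C₆(2,3) (the prism) and C₉(1,3).  Colourings of a complete graph are joined by
-- two jumps per vertex; in each of the circulants, a few jumps merge the colour
-- classes into a fixed 3-colouring, which leaves a renaming of three colours.

open import Defs
open import Data.Bool using (Bool; true; false)
open import Data.Empty using (⊥; ⊥-elim)
open import Data.Fin as Fin using (Fin; zero; suc; toℕ; punchIn; punchOut; #_; splitAt; join; inject≤)
open import Data.Fin.Properties
  using (any?; all?; _≟_; ¬∀⟶∃¬; <-cmp; injective⇒≤; inject≤-injective; punchIn-punchOut;
         punchIn-injective; splitAt-join)
open import Data.List as List using (List; []; _∷_; length)
open import Data.List.Membership.DecPropositional using (_∈?_)
open import Data.List.Membership.Propositional using (_∈_)
open import Data.List.Membership.Propositional.Properties using (∈-allFin)
open import Data.List.Properties using (length-tabulate)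
open import Data.List.Relation.Unary.All as All using (All; []; _∷_)
open import Data.List.Relation.Unary.All.Properties using (tabulate⁻)
open import Data.List.Relation.Unary.AllPairs using (AllPairs; []; _∷_)
open import Data.List.Relation.Unary.Any using (here; there)
open import Data.Nat using (ℕ; zero; suc; _+_; _*_; _^_; _≤_; _<_; z≤n; s≤s; NonZero)
open import Data.Nat.DivMod using (_mod_)
open import Data.Nat.Properties as ℕ using ()
open import Data.Product using (Σ; ∃; ∃₂; ∃-syntax; _×_; _,_; proj₁; proj₂)
open import Data.Sum as Sum using (_⊎_; inj₁; inj₂; [_,_]′)
open import Data.Vec using (Vec; []; _∷_; lookup; tabulate; _[_]≔_)
open import Data.Vec.Properties
  using (lookup∘tabulate; tabulate∘lookup; tabulate-cong; lookup∘update; lookup∘update′; ≡-dec)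
open import Function using (_∘_; id; case_of_)
open import Function.Bundles using (_⇔_; mk⇔; Equivalence)
open import Function.Definitions using (Injective)
open import Relation.Binary.Construct.Closure.ReflexiveTransitive using (ε; _◅_; _◅◅_)
open import Relation.Binary.Definitions using (DecidableEquality; tri<; tri≈; tri>)
open import Relation.Binary.PropositionalEquality
open import Relation.Nullary
open import Relation.Nullary.Decidable
import Relation.Unary as U

open Equivalence using (to; from)

-- Jumps are counted, not single recolourings, because a mimicking vertex changes in the same jump
-- as its model: a chain pulls back along a homomorphism without growing. Counted singly, each
-- recolouring of the model would cost one more for the mimic. Two jumps per vertex are just what
-- the circulants can afford: renaming three colours takes 6 jumps, and reaching the 3-colouring
-- from both ends gives 2+6+2, 3+6+3 and 5+6+5 against budgets of 10, 12 and 18. The classification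
-- splits on cliques. A `K₄` forces completeness. Without one, an incomplete graph has every edge in
-- at most one triangle, so a vertex outside a triangle is attached to exactly one corner, which
-- rigidly builds the prism and then `C₉`. Without triangles, two nonadjacent vertices lie on an
-- induced 5-cycle that admits no further vertex. Each circulant contains an odd cycle, hence
-- `4 ≤ ℓ`, and the fourth colour is what unlocks it.

private variable
  k ℓ m n : ℕ
  V W : Set

-- Chains of jumps and homomorphisms

-- Recolouring, one vertex at a time and in any order, from c to d stays proper
-- when Jump G c d holds between proper c and d.
Jump : Graph V → (V → Fin ℓ) → (V → Fin ℓ) → Set
Jump G c d = ∀ u v → Adj G u v → c u ≢ d v

Valid : Graph V → (V → Fin ℓ) → Set
Valid G c = Jump G c c

jump-sym : (G : Graph V) {c d : V → Fin ℓ} → Jump G c d → Jump G d c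
jump-sym G j u v e eq = j v u (adj-sym G e) (sym eq)

data Chain (G : Graph V) {ℓ} : ℕ → (V → Fin ℓ) → (V → Fin ℓ) → Set where
  stop : ∀ {c d} → c ≗ d → Chain G 0 c d
  step : ∀ {m c d e} → Jump G c d → Valid G d → Chain G m d e → Chain G (suc m) c e

module _ {G : Graph V} where

  recount : {c d : V → Fin ℓ} → m ≡ n → Chain G m c d → Chain G n c d
  recount refl p = p

  ≗-chain : {c c′ d : V → Fin ℓ} → c ≗ c′ → Chain G m c′ d → Chain G m c d
  ≗-chain c≗c′ (stop eq)     = stop λ v → trans (c≗c′ v) (eq v)
  ≗-chain c≗c′ (step j v p) = step (λ u w e eq → j u w e (trans (sym (c≗c′ u)) eq)) v p

  infixr 5 _++_
  _++_ : {c d e : V → Fin ℓ} → Chain G m c d → Chain G n d e → Chain G (m + n) c e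
  stop eq    ++ q = ≗-chain eq q
  step j v p ++ q = step j v (p ++ q)

  jump : {c d : V → Fin ℓ} → Jump G c d → Valid G d → Chain G 1 c d
  jump j v = step j v (stop λ _ → refl)

  reverse : {c d : V → Fin ℓ} → Valid G c → Chain G m c d → Chain G m d c
  reverse vc (stop eq) = stop (sym ∘ eq)
  reverse vc (step {m} j vd p) = recount (ℕ.+-comm m 1)
    (reverse vd p ++ jump (jump-sym G j) vc)

  pad : {c d : V → Fin ℓ} → Valid G c → Chain G m c d → m ≤ n → Chain G n c d
  pad {m = m} {c = c} {d} vc p m≤n =
    let k , m+k≡n = ℕ.m≤n⇒∃[o]m+o≡n m≤n
    in recount (trans (ℕ.+-comm k m) m+k≡n) (stutter k ++ p)
    where
    stutter : ∀ k → Chain G k c c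
    stutter zero    = stop λ _ → refl
    stutter (suc k) = step vc vc (stutter k)

Hom : Graph V → Graph W → (V → W) → Set
Hom G H f = ∀ {u v} → Adj G u v → Adj H (f u) (f v)

pullback : {G : Graph V} {H : Graph W} {f : V → W} {c d : W → Fin ℓ} →
           Hom G H f → Chain H m c d → Chain G m (c ∘ f) (d ∘ f)
pullback hom (stop eq)    = stop λ _ → eq _
pullback hom (step j v p) =
  step (λ _ _ e → j _ _ (hom e)) (λ _ _ e → v _ _ (hom e)) (pullback hom p)

JumpConnected : Graph V → ℕ → ℕ → Set
JumpConnected G ℓ m = ∀ {c d : _ → Fin ℓ} → Valid G c → Valid G d → Chain G m c d

transfer : {G : Graph V} {H : Graph W} {f : V → W} {g : W → V} →
           Hom G H f → Hom H G g → (∀ v → g (f v) ≡ v) →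
           JumpConnected H ℓ m → JumpConnected G ℓ m
transfer {G = G} {f = f} {g} homf homg gf≡id conn {c} {d} vc vd =
  recount (ℕ.+-identityʳ _)
    (≗-chain (λ v → cong c (sym (gf≡id v)))
      (pullback homf (conn (λ _ _ e → vc _ _ (homg e)) (λ _ _ e → vd _ _ (homg e)))
        ++ stop λ v → cong d (gf≡id v)))

-- The vertices moved by g ∘ f first copy the colours of their images, and
-- keep mimicking them.
fold : {G : Graph V} {H : Graph W} {f : V → W} {g : W → V} →
       Hom G H f → Hom H G g → (∀ {u v} → Adj G u v → Adj G u (g (f v))) →
       JumpConnected H ℓ m → JumpConnected G ℓ (2 + m)
fold {ℓ = ℓ} {m} {G = G} {f = f} {g} homf homg shift conn {c} {d} vc vd =
  recount (cong suc (ℕ.+-comm m 1))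
    (fold-jump vc
      ++ pullback homf (conn (λ _ _ e → vc _ _ (homg e)) (λ _ _ e → vd _ _ (homg e)))
      ++ reverse vd (fold-jump vd))
  where
  fold-jump : {c : _ → Fin ℓ} → Valid G c → Chain G 1 c (c ∘ g ∘ f)
  fold-jump vc = jump (λ u v e → vc _ _ (shift e)) (λ _ _ e → vc _ _ (homg (homf e)))

induce : (W → V) → Graph V → Graph W
induce f G = record
  { Adj        = λ u v → Adj G (f u) (f v)
  ; adj?       = λ u v → adj? G (f u) (f v)
  ; adj-sym    = adj-sym G
  ; adj-irrefl = λ v → adj-irrefl G (f v)
  }

remove-dominated : (G : Graph (Fin (suc n))) {u v : Fin (suc n)} → u ≢ v →
  (∀ w → Adj G u w → Adj G v w) →
  JumpConnected (induce (punchIn u) G) ℓ m → JumpConnected G ℓ (2 + m)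
remove-dominated {n} G {u} {v} u≢v N⊆ =
  -- `shift` moves one end of an edge; applied to both ends in turn it makes `f` a homomorphism.
  fold {f = f} {g = punchIn u} (λ e → shift (adj-sym G (shift (adj-sym G e)))) id shift
  where
  f : Fin (suc n) → Fin n
  f w with u ≟ w
  ... | yes _  = punchOut u≢v
  ... | no u≢w = punchOut u≢w

  shift : ∀ {x w} → Adj G x w → Adj G x (punchIn u (f w))
  shift {x} {w} e with u ≟ w
  ... | yes refl rewrite punchIn-punchOut u≢v = adj-sym G (N⊆ x (adj-sym G e))
  ... | no u≢w rewrite punchIn-punchOut u≢w = e

-- Spare colours and colourings of complete graphs

fresh : m < ℓ → (f : Fin m → Fin ℓ) → ∃[ x ] (∀ i → f i ≢ x)
fresh {m} {ℓ} m<ℓ f with any? (λ x → all? λ i → ¬? (f i ≟ x))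
... | yes free = free
... | no full = contradiction (injective⇒≤ {f = f⁻¹} f⁻¹-injective) (ℕ.<⇒≱ m<ℓ)
  where
  preimage : ∀ x → ∃[ i ] f i ≡ x
  preimage x with any? (λ i → f i ≟ x)
  ... | yes p = p
  ... | no ¬p = contradiction (x , λ i eq → ¬p (i , eq)) full

  f⁻¹ : Fin ℓ → Fin m
  f⁻¹ = proj₁ ∘ preimage

  f⁻¹-injective : ∀ {x y} → f⁻¹ x ≡ f⁻¹ y → x ≡ y
  f⁻¹-injective eq =
    trans (sym (proj₂ (preimage _))) (trans (cong f eq) (proj₂ (preimage _)))

module _ {G : Graph V} {c d : V → Fin ℓ} where

  -- The order inside a jump is free, so a new colour has to avoid both the old and the new colours
  -- around it. An edge is checked from an end that moves; if neither does, `vc` covers it.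
  move : Valid G c →
         (∀ v → c v ≡ d v ⊎ (∀ {w} → Adj G v w → c w ≢ d v × d w ≢ d v)) →
         Jump G c d × Valid G d
  move vc moved = jump′ , valid
    where
    jump′ : Jump G c d
    jump′ u v e eq with moved v
    ... | inj₁ same  = vc u v e (trans eq (sym same))
    ... | inj₂ avoid = proj₁ (avoid (adj-sym G e)) eq

    valid : Valid G d
    valid u v e eq with moved u
    ... | inj₁ same  = jump′ u v e (trans same eq)
    ... | inj₂ avoid = proj₂ (avoid e) (sym eq)

  move-chain : Valid G c →
         (∀ v → c v ≡ d v ⊎ (∀ {w} → Adj G v w → c w ≢ d v × d w ≢ d v)) →
         Chain G 1 c d × Valid G d
  move-chain vc moved = let j , v = move vc moved in jump j v , v

module _ (m<ℓ : m < ℓ) (d : Fin m → Fin ℓ) (valid-d : Valid (complete m) d) where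

  private
    Km = complete m

    -- At most one vertex holds `d i`; it steps aside to the spare colour `x`, and then `i` takes
    -- `d i`. An already settled `j` other than `i` never has to step aside, as `d j ≢ d i`.
    settle : ∀ i {c : Fin m → Fin ℓ} → Valid Km c →
      ∃[ e ] Chain Km 2 c e × Valid Km e × e i ≡ d i × (∀ j → c j ≡ d j → e j ≡ d j)
    settle i {c} vc = e , chain , valid-e , e-i , e-settled
      where
      x  = proj₁ (fresh m<ℓ c)
      c≢x = proj₂ (fresh m<ℓ c)

      c₁ : Fin m → Fin ℓ
      c₁ j with c j ≟ d i
      ... | yes _ = x
      ... | no  _ = c j

      e : Fin m → Fin ℓ
      e j with j ≟ i
      ... | yes _ = d i
      ... | no  _ = c₁ j

      c₁≢di : ∀ j → c₁ j ≢ d i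
      c₁≢di j eq with c j ≟ d i
      ... | yes p = c≢x j (trans p (sym eq))
      ... | no ¬p = ¬p eq

      moved₁ : ∀ j → c j ≡ c₁ j ⊎ (∀ {w} → j ≢ w → c w ≢ c₁ j × c₁ w ≢ c₁ j)
      moved₁ j with c j ≟ d i
      ... | no _  = inj₁ refl
      ... | yes p = inj₂ λ {w} j≢w → c≢x w , other w j≢w
        where
        other : ∀ w → j ≢ w → c₁ w ≢ x
        other w j≢w eq with c w ≟ d i
        ... | yes q = vc j w j≢w (trans p (sym q))
        ... | no _  = c≢x w eq

      moved₂ : ∀ j → c₁ j ≡ e j ⊎ (∀ {w} → j ≢ w → c₁ w ≢ e j × e w ≢ e j)
      moved₂ j with j ≟ i
      ... | no _     = inj₁ refl
      ... | yes refl = inj₂ λ {w} j≢w → c₁≢di w , other w j≢w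
        where
        other : ∀ w → j ≢ w → e w ≢ d i
        other w j≢w with w ≟ i
        ... | yes refl = contradiction refl j≢w
        ... | no _     = c₁≢di w

      first   = move-chain {G = Km} vc moved₁
      second  = move-chain {G = Km} (proj₂ first) moved₂
      chain   = proj₁ first ++ proj₁ second
      valid-e = proj₂ second

      e-i : e i ≡ d i
      e-i with i ≟ i
      ... | yes _  = refl
      ... | no i≢i = contradiction refl i≢i

      e-settled : ∀ j → c j ≡ d j → e j ≡ d j
      e-settled j eq with j ≟ i
      ... | yes refl = refl
      ... | no j≢i with c j ≟ d i
      ...   | yes p = contradiction (trans (sym eq) p) (valid-d j i j≢i)
      ...   | no _  = eq

    settle-all : ∀ L {c : Fin m → Fin ℓ} → Valid Km c → (∀ j → c j ≡ d j ⊎ j ∈ L) →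
                 Chain Km (length L * 2) c d
    settle-all []      vc rest = stop λ j → [ id , (λ ()) ]′ (rest j)
    settle-all (i ∷ L) vc rest =
      let e , chain , valid-e , e-i , kept = settle i vc
      in chain ++ settle-all L valid-e λ j → case rest j of λ where
           (inj₁ eq)          → inj₁ (kept j eq)
           (inj₂ (here refl)) → inj₁ e-i
           (inj₂ (there j∈L)) → inj₂ j∈L

  complete-chain : {c : Fin m → Fin ℓ} → Valid Km c → Chain Km (m * 2) c d
  complete-chain vc =
    recount (cong (_* 2) (length-tabulate (id {A = Fin m})))
      (settle-all (List.allFin m) vc λ j → inj₂ (∈-allFin j))

complete-connected : m < ℓ → JumpConnected (complete m) ℓ (m * 2)
complete-connected m<ℓ vc vd = complete-chain m<ℓ _ vd vc

-- Three circulants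

-- The order of this list is the order in which the arguments of `put` treat the neighbours below.
neighbours : ∀ m .⦃ _ : NonZero m ⦄ → List ℕ → Fin m → List (Fin m)
neighbours m S i = List.map (λ s → (toℕ i + s) mod m) S

private
  _∈Fin?_ : (i : Fin m) (L : List (Fin m)) → Dec (i ∈ L)
  _∈Fin?_ = _∈?_ _≟_

Undirected : ∀ m .⦃ _ : NonZero m ⦄ → List ℕ → Set
Undirected m S =
  True (all? λ i → all? λ j → (j ∈Fin? neighbours m S i) →-dec (i ∈Fin? neighbours m S j)) ×
  True (all? λ i → ¬? (i ∈Fin? neighbours m S i))

circulant : ∀ m .⦃ _ : NonZero m ⦄ (S : List ℕ) → {Undirected m S} → Graph (Fin m)
circulant m S {symmetric , irreflexive} = record
  { Adj        = λ i j → j ∈ neighbours m S i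
  ; adj?       = λ i j → j ∈Fin? neighbours m S i
  ; adj-sym    = λ {i} {j} → toWitness symmetric i j
  ; adj-irrefl = toWitness irreflexive
  }

C₅ : Graph (Fin 5)
C₅ = circulant 5 (1 ∷ 4 ∷ [])

-- The triangular prism: the triangles are the two parity classes.
C₆ : Graph (Fin 6)
C₆ = circulant 6 (2 ∷ 3 ∷ 4 ∷ [])

C₉ : Graph (Fin 9)
C₉ = circulant 9 (1 ∷ 3 ∷ 6 ∷ 8 ∷ [])

differ : (G : Graph V) {c : V → Fin ℓ} → Valid G c →
         ∀ u v {_ : True (adj? G u v)} → c u ≢ c v
differ G vc u v {e} = vc u v (toWitness e)

agree : {c d : Fin m → Fin ℓ} → All (λ v → c v ≡ d v) (List.allFin m) → c ≗ d
agree = tabulate⁻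

fresh₃ : 4 ≤ ℓ → ∀ (x y z : Fin ℓ) → ∃[ f ] x ≢ f × y ≢ f × z ≢ f
fresh₃ 4≤ℓ x y z =
  let f , avoid = fresh 4≤ℓ (lookup (x ∷ y ∷ z ∷ []))
  in f , avoid (# 0) , avoid (# 1) , avoid (# 2)

module _ (H : Graph (Fin m)) (γ : Fin m → Fin 3) (t : ℕ) where

  Reduct : (Fin m → Fin ℓ) → Set
  Reduct c = ∃₂ λ d h → Chain H t c d × Valid H d × d ≗ h ∘ γ

  Reducible : ℕ → Set
  Reducible ℓ = ∀ {c : Fin m → Fin ℓ} → Valid H c → Reduct c

  -- Renaming the three colours of h takes at most 6 jumps.
  reducible⇒connected : 3 < ℓ →
    {True (all? λ u → all? λ v → adj? H u v →-dec ¬? (γ u ≟ γ v))} →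
    {True (all? λ x → all? λ y → ¬? (x ≟ y) →-dec
      any? λ u → any? λ v → adj? H u v ×-dec (γ u ≟ x ×-dec γ v ≟ y))} →
    Reducible ℓ → JumpConnected H ℓ (t + 6 + t)
  reducible⇒connected {ℓ} 3<ℓ {hom} {onto} reduce vc vd =
    let c′ , g , p , vc′ , c′≗g = reduce vc
        d′ , h , q , vd′ , d′≗h = reduce vd
        rename = pullback {H = complete 3} (toWitness hom _ _)
                   (complete-connected 3<ℓ (valid g vc′ c′≗g) (valid h vd′ d′≗h))
    in recount (sym (ℕ.+-assoc t 6 t))
         (p ++ ≗-chain c′≗g (rename ++ ≗-chain (sym ∘ d′≗h) (reverse vd q)))
    where
    -- Any two distinct colours of `γ` occur along an edge of `H`, so properness of `d` separates
    -- the values of `h`.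
    valid : ∀ {d : Fin m → Fin ℓ} (h : Fin 3 → Fin ℓ) →
            Valid H d → d ≗ h ∘ γ → Valid (complete 3) h
    valid h vd d≗h x y x≢y eq with toWitness onto x y x≢y
    ... | u , v , e , refl , refl = vd u v e (trans (d≗h u) (trans eq (sym (d≗h v))))

paint : .⦃ _ : NonZero m ⦄ {S : List ℕ} {und : Undirected m S} {c d : Fin m → Fin ℓ} →
  let H = circulant m S {und} in Valid H c →
  All (λ v → c v ≡ d v ⊎ All (λ w → c w ≢ d v × d w ≢ d v) (neighbours m S v)) (List.allFin m) →
  Chain H 1 c d × Valid H d
paint vc moved = move-chain vc λ v → Sum.map₂ All.lookup (tabulate⁻ moved v)

pattern keep = inj₁ refl
pattern put ps = inj₂ ps

-- When w keeps its colour, the two conditions on w in paint coincide.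
twice : {A : Set} → A → A × A
twice x = x , x

γ₅ : Fin 5 → Fin 3
γ₅ = lookup (# 0 ∷ # 1 ∷ # 0 ∷ # 1 ∷ # 2 ∷ [])

-- 1 can copy 3 unless 0 has that colour. In that case 4 sees a single colour, so its new colour can
-- also spare those of 1 and 2, after which 0 copies 2 and 3 copies 1.
C₅-reducible : 4 ≤ ℓ → Reducible C₅ γ₅ 2 ℓ
C₅-reducible {ℓ} 4≤ℓ {c} v = go
  where
  x₀ = c (# 0); x₁ = c (# 1); x₂ = c (# 2); x₃ = c (# 3); x₄ = c (# 4)
  go : Reduct C₅ γ₅ 2 c
  go with x₀ ≟ x₃
  ... | no x₀≢x₃ =
    let f , x₀≢f , x₂≢f , x₃≢f = fresh₃ 4≤ℓ x₀ x₂ x₃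
        p , v₁ = paint {d = lookup (x₀ ∷ x₃ ∷ x₂ ∷ x₃ ∷ f ∷ [])} v
                   (keep ∷ put (twice (differ C₅ v (# 2) (# 3)) ∷ twice x₀≢x₃ ∷ []) ∷
                    keep ∷ keep ∷ put (twice x₀≢f ∷ twice x₃≢f ∷ []) ∷ [])
        q , v₂ = paint {d = lookup (x₂ ∷ x₃ ∷ x₂ ∷ x₃ ∷ f ∷ [])} v₁
                   (put (twice (differ C₅ v (# 3) (# 2)) ∷ twice (≢-sym x₂≢f) ∷ []) ∷
                    keep ∷ keep ∷ keep ∷ keep ∷ [])
    in _ , lookup (x₂ ∷ x₃ ∷ f ∷ []) , p ++ q , v₂ ,
       agree (refl ∷ refl ∷ refl ∷ refl ∷ refl ∷ [])
  ... | yes x₀≡x₃ =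
    let f , x₀≢f , x₁≢f , x₂≢f = fresh₃ 4≤ℓ x₀ x₁ x₂
        p , v₁ = paint {d = lookup (x₀ ∷ x₁ ∷ x₂ ∷ x₃ ∷ f ∷ [])} v
                   (keep ∷ keep ∷ keep ∷ keep ∷
                    put (twice x₀≢f ∷ twice (subst (_≢ f) x₀≡x₃ x₀≢f) ∷ []) ∷ [])
        q , v₂ = paint {d = lookup (x₂ ∷ x₁ ∷ x₂ ∷ x₁ ∷ f ∷ [])} v₁
                   (put (twice (differ C₅ v (# 1) (# 2)) ∷ twice (≢-sym x₂≢f) ∷ []) ∷
                    keep ∷ keep ∷
                    put (twice (≢-sym x₁≢f) ∷ twice (differ C₅ v (# 2) (# 1)) ∷ []) ∷ keep ∷ [])
    in _ , lookup (x₂ ∷ x₁ ∷ f ∷ []) , p ++ q , v₂ ,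
       agree (refl ∷ refl ∷ refl ∷ refl ∷ refl ∷ [])

γ₆ : Fin 6 → Fin 3
γ₆ = lookup (# 0 ∷ # 0 ∷ # 1 ∷ # 1 ∷ # 2 ∷ # 2 ∷ [])

-- The neighbours of 0 and 1 differ only in 2 and 5, so unless 0 can take the
-- colour of 1 or conversely, 2 has the colour of 1 and 5 that of 0, and then
-- 2 has a fourth colour to move to.
C₆-reducible : 4 ≤ ℓ → Reducible C₆ γ₆ 3 ℓ
C₆-reducible {ℓ} 4≤ℓ {c} v = let d , p , vd , d₀≡d₁ = equalise in finish p vd d₀≡d₁
  where
  x₀ = c (# 0); x₁ = c (# 1); x₂ = c (# 2); x₃ = c (# 3); x₄ = c (# 4); x₅ = c (# 5)

  equalise : ∃[ d ] Chain C₆ 2 c d × Valid C₆ d × d (# 0) ≡ d (# 1)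
  equalise with x₂ ≟ x₁ | x₅ ≟ x₀
  ... | no x₂≢x₁ | _ =
    let p , v₁ = paint {d = lookup (x₁ ∷ x₁ ∷ x₂ ∷ x₃ ∷ x₄ ∷ x₅ ∷ [])} v
                   (put (twice x₂≢x₁ ∷ twice (differ C₆ v (# 3) (# 1)) ∷
                         twice (differ C₆ v (# 4) (# 1)) ∷ []) ∷
                    keep ∷ keep ∷ keep ∷ keep ∷ keep ∷ [])
    in _ , pad v p (s≤s z≤n) , v₁ , refl
  ... | yes _ | no x₅≢x₀ =
    let p , v₁ = paint {d = lookup (x₀ ∷ x₀ ∷ x₂ ∷ x₃ ∷ x₄ ∷ x₅ ∷ [])} v
                   (keep ∷
                    put (twice (differ C₆ v (# 3) (# 0)) ∷ twice (differ C₆ v (# 4) (# 0)) ∷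
                         twice x₅≢x₀ ∷ []) ∷
                    keep ∷ keep ∷ keep ∷ keep ∷ [])
    in _ , pad v p (s≤s z≤n) , v₁ , refl
  ... | yes x₂≡x₁ | yes x₅≡x₀ =
    let f , x₀≢f , x₁≢f , x₄≢f = fresh₃ 4≤ℓ x₀ x₁ x₄
        p , v₁ = paint {d = lookup (x₀ ∷ x₁ ∷ f ∷ x₃ ∷ x₄ ∷ x₅ ∷ [])} v
                   (keep ∷ keep ∷
                    put (twice x₄≢f ∷ twice (subst (_≢ f) (sym x₅≡x₀) x₀≢f) ∷ twice x₀≢f ∷ []) ∷
                    keep ∷ keep ∷ keep ∷ [])
        q , v₂ = paint {d = lookup (x₁ ∷ x₁ ∷ f ∷ x₃ ∷ x₄ ∷ x₅ ∷ [])} v₁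
                   (put (twice (≢-sym x₁≢f) ∷ twice (differ C₆ v (# 3) (# 1)) ∷
                         twice (differ C₆ v (# 4) (# 1)) ∷ []) ∷
                    keep ∷ keep ∷ keep ∷ keep ∷ keep ∷ [])
    in _ , p ++ q , v₂ , refl

  -- With 0 and 1 alike, the neighbour 1 of 3 shows the colour of 0, which 2 avoids, so 3 can copy
  -- 2; symmetrically 4 can copy 5. As 3 and 4 are not adjacent, one jump does both.
  finish : ∀ {d} → Chain C₆ 2 c d → Valid C₆ d → d (# 0) ≡ d (# 1) → Reduct C₆ γ₆ 3 c
  finish {d} p vd d₀≡d₁ =
    let d₀ = d (# 0); d₁ = d (# 1); d₂ = d (# 2); d₅ = d (# 5)
        q , v₁ = paint {d = lookup (d₀ ∷ d₁ ∷ d₂ ∷ d₂ ∷ d₅ ∷ d₅ ∷ [])} vd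
                   (keep ∷ keep ∷ keep ∷
                    put (twice (differ C₆ vd (# 5) (# 2)) ∷ twice (differ C₆ vd (# 0) (# 2)) ∷
                         twice (subst (_≢ d₂) d₀≡d₁ (differ C₆ vd (# 0) (# 2))) ∷ []) ∷
                    put (twice (subst (_≢ d₅) (sym d₀≡d₁) (differ C₆ vd (# 1) (# 5))) ∷
                         twice (differ C₆ vd (# 1) (# 5)) ∷ twice (differ C₆ vd (# 2) (# 5)) ∷ []) ∷
                    keep ∷ [])
    in _ , lookup (d₀ ∷ d₂ ∷ d₅ ∷ []) , p ++ q , v₁ ,
       agree (refl ∷ sym d₀≡d₁ ∷ refl ∷ refl ∷ refl ∷ refl ∷ [])

γ₉ : Fin 9 → Fin 3
γ₉ = lookup (# 0 ∷ # 2 ∷ # 0 ∷ # 1 ∷ # 0 ∷ # 1 ∷ # 2 ∷ # 1 ∷ # 2 ∷ [])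

-- First 0 and 2 are given the same colour, as their neighbours differ only in
-- 6 and 5; then 4 is given that colour too.  The other vertices induce a chain
-- graph.
C₉-reducible : 4 ≤ ℓ → Reducible C₉ γ₉ 5 ℓ
C₉-reducible {ℓ} 4≤ℓ {c} v = let d , p , vd , d₀≡d₂ = equalise in finish p vd d₀≡d₂
  where
  x₀ = c (# 0); x₁ = c (# 1); x₂ = c (# 2); x₃ = c (# 3); x₄ = c (# 4)
  x₅ = c (# 5); x₆ = c (# 6); x₇ = c (# 7); x₈ = c (# 8)

  x≢ : ∀ i j {_ : True (adj? C₉ i j)} → c i ≢ c j
  x≢ i j {e} = differ C₉ v i j {e}

  equalise : ∃[ d ] Chain C₉ 2 c d × Valid C₉ d × d (# 0) ≡ d (# 2)
  equalise with x₆ ≟ x₂ | x₅ ≟ x₀ | x₄ ≟ x₂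
  ... | no x₆≢x₂ | _ | _ =
    let p , v₁ = paint {d = lookup (x₂ ∷ x₁ ∷ x₂ ∷ x₃ ∷ x₄ ∷ x₅ ∷ x₆ ∷ x₇ ∷ x₈ ∷ [])} v
                   (put (twice (x≢ (# 1) (# 2)) ∷ twice (x≢ (# 3) (# 2)) ∷ twice x₆≢x₂ ∷
                         twice (x≢ (# 8) (# 2)) ∷ []) ∷
                    keep ∷ keep ∷ keep ∷ keep ∷ keep ∷ keep ∷ keep ∷ keep ∷ [])
    in _ , pad v p (s≤s z≤n) , v₁ , refl
  ... | yes _ | no x₅≢x₀ | _ =
    let p , v₁ = paint {d = lookup (x₀ ∷ x₁ ∷ x₀ ∷ x₃ ∷ x₄ ∷ x₅ ∷ x₆ ∷ x₇ ∷ x₈ ∷ [])} v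
                   (keep ∷ keep ∷
                    put (twice (x≢ (# 3) (# 0)) ∷ twice x₅≢x₀ ∷ twice (x≢ (# 8) (# 0)) ∷
                         twice (x≢ (# 1) (# 0)) ∷ []) ∷
                    keep ∷ keep ∷ keep ∷ keep ∷ keep ∷ keep ∷ [])
    in _ , pad v p (s≤s z≤n) , v₁ , refl
  -- Three of the four neighbours of 5 carry `x₂`, so only `x₂` and `x₈` are barred there; avoiding
  -- `x₀` as well frees `x₀` for 2.
  ... | yes x₆≡x₂ | yes x₅≡x₀ | yes x₄≡x₂ =
    let f , x₀≢f , x₂≢f , x₈≢f = fresh₃ 4≤ℓ x₀ x₂ x₈
        p , v₁ = paint {d = lookup (x₀ ∷ x₁ ∷ x₂ ∷ x₃ ∷ x₄ ∷ f ∷ x₆ ∷ x₇ ∷ x₈ ∷ [])} v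
                   (keep ∷ keep ∷ keep ∷ keep ∷ keep ∷
                    put (twice (subst (_≢ f) (sym x₆≡x₂) x₂≢f) ∷ twice x₈≢f ∷ twice x₂≢f ∷
                         twice (subst (_≢ f) (sym x₄≡x₂) x₂≢f) ∷ []) ∷
                    keep ∷ keep ∷ keep ∷ [])
        q , v₂ = paint {d = lookup (x₀ ∷ x₁ ∷ x₀ ∷ x₃ ∷ x₄ ∷ f ∷ x₆ ∷ x₇ ∷ x₈ ∷ [])} v₁
                   (keep ∷ keep ∷
                    put (twice (x≢ (# 3) (# 0)) ∷ twice (≢-sym x₀≢f) ∷ twice (x≢ (# 8) (# 0)) ∷
                         twice (x≢ (# 1) (# 0)) ∷ []) ∷
                    keep ∷ keep ∷ keep ∷ keep ∷ keep ∷ keep ∷ [])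
    in _ , p ++ q , v₂ , refl
  -- 6 can copy 4: they share the neighbours 3, 5 and 7, and the remaining neighbour 0 of 6 has the
  -- colour of 5. This frees `x₂` for 0.
  ... | yes x₆≡x₂ | yes x₅≡x₀ | no x₄≢x₂ =
    let p , v₁ = paint {d = lookup (x₀ ∷ x₁ ∷ x₂ ∷ x₃ ∷ x₄ ∷ x₅ ∷ x₄ ∷ x₇ ∷ x₈ ∷ [])} v
                   (keep ∷ keep ∷ keep ∷ keep ∷ keep ∷ keep ∷
                    put (twice (x≢ (# 7) (# 4)) ∷ twice (subst (_≢ x₄) x₅≡x₀ (x≢ (# 5) (# 4))) ∷
                         twice (x≢ (# 3) (# 4)) ∷ twice (x≢ (# 5) (# 4)) ∷ []) ∷
                    keep ∷ keep ∷ [])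
        q , v₂ = paint {d = lookup (x₂ ∷ x₁ ∷ x₂ ∷ x₃ ∷ x₄ ∷ x₅ ∷ x₄ ∷ x₇ ∷ x₈ ∷ [])} v₁
                   (put (twice (x≢ (# 1) (# 2)) ∷ twice (x≢ (# 3) (# 2)) ∷ twice x₄≢x₂ ∷
                         twice (x≢ (# 8) (# 2)) ∷ []) ∷
                    keep ∷ keep ∷ keep ∷ keep ∷ keep ∷ keep ∷ keep ∷ keep ∷ [])
    in _ , p ++ q , v₂ , refl

  finish : ∀ {d} → Chain C₉ 2 c d → Valid C₉ d → d (# 0) ≡ d (# 2) → Reduct C₉ γ₉ 5 c
  finish {d} p vd d₀≡d₂ = go
    where
    y₀ = d (# 0); y₁ = d (# 1); y₂ = d (# 2); y₃ = d (# 3); y₄ = d (# 4)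
    y₅ = d (# 5); y₆ = d (# 6); y₇ = d (# 7); y₈ = d (# 8)

    y≢ : ∀ i j {_ : True (adj? C₉ i j)} → d i ≢ d j
    y≢ i j {e} = differ C₉ vd i j {e}

    y₀≢y₅ : y₀ ≢ y₅
    y₀≢y₅ = subst (_≢ y₅) (sym d₀≡d₂) (y≢ (# 2) (# 5))

    go : Reduct C₉ γ₉ 5 c
    go with y₇ ≟ y₀
    -- Only 7 could bar 4 from `y₀`, since 1 and 3 are adjacent to 0, and 5 to 2. Afterwards 3 and 5
    -- copy 7, then 1 and 6 copy 8.
    ... | no y₇≢y₀ =
      let q₁ , v₁ = paint {d = lookup (y₀ ∷ y₁ ∷ y₂ ∷ y₃ ∷ y₀ ∷ y₅ ∷ y₆ ∷ y₇ ∷ y₈ ∷ [])} vd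
                      (keep ∷ keep ∷ keep ∷ keep ∷
                       put (twice (≢-sym y₀≢y₅) ∷ twice y₇≢y₀ ∷ twice (y≢ (# 1) (# 0)) ∷
                            twice (y≢ (# 3) (# 0)) ∷ []) ∷
                       keep ∷ keep ∷ keep ∷ keep ∷ [])
          q₂ , v₂ = paint {d = lookup (y₀ ∷ y₁ ∷ y₂ ∷ y₇ ∷ y₀ ∷ y₇ ∷ y₆ ∷ y₇ ∷ y₈ ∷ [])} v₁
                      (keep ∷ keep ∷ keep ∷
                       put (twice (≢-sym y₇≢y₀) ∷ twice (y≢ (# 6) (# 7)) ∷ twice (≢-sym y₇≢y₀) ∷
                            twice (subst (_≢ y₇) d₀≡d₂ (≢-sym y₇≢y₀)) ∷ []) ∷
                       keep ∷
                       put (twice (y≢ (# 6) (# 7)) ∷ twice (y≢ (# 8) (# 7)) ∷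
                            twice (subst (_≢ y₇) d₀≡d₂ (≢-sym y₇≢y₀)) ∷ twice (≢-sym y₇≢y₀) ∷ []) ∷
                       keep ∷ keep ∷ keep ∷ [])
          q₃ , v₃ = paint {d = lookup (y₀ ∷ y₈ ∷ y₂ ∷ y₇ ∷ y₀ ∷ y₇ ∷ y₈ ∷ y₇ ∷ y₈ ∷ [])} v₂
                      (keep ∷
                       put (twice (y≢ (# 2) (# 8)) ∷ twice (y≢ (# 0) (# 8)) ∷
                            twice (y≢ (# 7) (# 8)) ∷ twice (y≢ (# 0) (# 8)) ∷ []) ∷
                       keep ∷ keep ∷ keep ∷ keep ∷
                       put (twice (y≢ (# 7) (# 8)) ∷ twice (y≢ (# 0) (# 8)) ∷
                            twice (y≢ (# 7) (# 8)) ∷ twice (y≢ (# 7) (# 8)) ∷ []) ∷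
                       keep ∷ keep ∷ [])
      in _ , lookup (y₀ ∷ y₇ ∷ y₈ ∷ []) , p ++ q₁ ++ q₂ ++ q₃ , v₃ ,
         agree (refl ∷ refl ∷ sym d₀≡d₂ ∷ refl ∷ refl ∷ refl ∷ refl ∷ refl ∷ refl ∷ [])
    -- Here 7 must first leave `y₀` for `y₅`, which among its neighbours only 1 can hold. As 0, 2
    -- and 7 are alike, 1 and 8 can both go to one colour `r`.
    ... | yes y₇≡y₀ =
      let r , y₀≢r , y₄≢r , y₅≢r = fresh₃ 4≤ℓ y₀ y₄ y₅
          y₂≢r = subst (_≢ r) d₀≡d₂ y₀≢r
          y₇≢r = subst (_≢ r) (sym y₇≡y₀) y₀≢r
          q₁ , v₁ = paint {d = lookup (y₀ ∷ r ∷ y₂ ∷ y₃ ∷ y₄ ∷ y₅ ∷ y₆ ∷ y₇ ∷ r ∷ [])} vd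
                      (keep ∷
                       put (twice y₂≢r ∷ twice y₄≢r ∷ twice y₇≢r ∷ twice y₀≢r ∷ []) ∷
                       keep ∷ keep ∷ keep ∷ keep ∷ keep ∷ keep ∷
                       put (twice y₀≢r ∷ twice y₂≢r ∷ twice y₅≢r ∷ twice y₇≢r ∷ []) ∷ [])
          q₂ , v₂ = paint {d = lookup (y₀ ∷ r ∷ y₂ ∷ y₅ ∷ y₄ ∷ y₅ ∷ y₆ ∷ y₅ ∷ r ∷ [])} v₁
                      (keep ∷ keep ∷ keep ∷
                       put (twice (y≢ (# 4) (# 5)) ∷ twice (y≢ (# 6) (# 5)) ∷ twice y₀≢y₅ ∷
                            twice (y≢ (# 2) (# 5)) ∷ []) ∷
                       keep ∷ keep ∷ keep ∷
                       put (twice (≢-sym y₅≢r) ∷ twice (≢-sym y₅≢r) ∷ twice (y≢ (# 4) (# 5)) ∷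
                            twice (y≢ (# 6) (# 5)) ∷ []) ∷
                       keep ∷ [])
          q₃ , v₃ = paint {d = lookup (y₀ ∷ r ∷ y₂ ∷ y₅ ∷ y₀ ∷ y₅ ∷ r ∷ y₅ ∷ r ∷ [])} v₂
                      (keep ∷ keep ∷ keep ∷ keep ∷
                       put (twice (≢-sym y₀≢y₅) ∷ twice (≢-sym y₀≢y₅) ∷ twice (≢-sym y₀≢r) ∷
                            twice (≢-sym y₀≢y₅) ∷ []) ∷
                       keep ∷
                       put (twice y₅≢r ∷ twice y₀≢r ∷ twice y₅≢r ∷ twice y₅≢r ∷ []) ∷
                       keep ∷ keep ∷ [])
      in _ , lookup (y₀ ∷ y₅ ∷ r ∷ []) , p ++ q₁ ++ q₂ ++ q₃ , v₃ ,
         agree (refl ∷ refl ∷ sym d₀≡d₂ ∷ refl ∷ refl ∷ refl ∷ refl ∷ refl ∷ refl ∷ [])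

C₅-connected : 4 ≤ ℓ → JumpConnected C₅ ℓ (5 * 2)
C₅-connected 4≤ℓ = reducible⇒connected C₅ γ₅ 2 4≤ℓ (C₅-reducible 4≤ℓ)

C₆-connected : 4 ≤ ℓ → JumpConnected C₆ ℓ (6 * 2)
C₆-connected 4≤ℓ = reducible⇒connected C₆ γ₆ 3 4≤ℓ (C₆-reducible 4≤ℓ)

C₉-connected : 4 ≤ ℓ → JumpConnected C₉ ℓ (9 * 2)
C₉-connected 4≤ℓ vc vd =
  pad vc (reducible⇒connected C₉ γ₉ 5 4≤ℓ (C₉-reducible 4≤ℓ) vc vd) (ℕ.m≤m+n 16 2)

-- Induced copies and the structure of irreducible graphs

-- Injectivity is left out because `separated` recovers it when, for distinct `i` and `j`, some
-- neighbour of `i` is not one of `j`.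
Copy : Graph (Fin m) → Graph V → (Fin m → V) → Set
Copy H G e = ∀ i j → Adj H i j ⇔ Adj G (e i) (e j)

Matches : Bool → Set → Set
Matches true  A = A
Matches false A = ¬ A

matches⇒⇔ : {A B : Set} (a? : Dec A) → Matches (does a?) B → A ⇔ B
matches⇒⇔ (yes a) b  = mk⇔ (λ _ → b) (λ _ → a)
matches⇒⇔ (no ¬a) ¬b = mk⇔ (λ a → contradiction a ¬a) (λ b → contradiction b ¬b)

lookup-pairs : {A : Set} {R : A → A → Set} {f : Fin m → A} →
  AllPairs R (List.tabulate f) → ∀ {i j} → i Fin.< j → R (f i) (f j)
lookup-pairs (rs ∷ _)  {zero}  {suc j} _         = tabulate⁻ rs j
lookup-pairs (_ ∷ prs) {suc i} {suc j} (s≤s i<j) = lookup-pairs prs i<j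

-- The argument is the upper triangle of the adjacency matrix, row by row; each entry's type
-- computes to an adjacency or a nonadjacency.
copy : (G : Graph V) (H : Graph (Fin m)) (e : Fin m → V) →
  AllPairs (λ i j → Matches (does (adj? H i j)) (Adj G (e i) (e j))) (List.allFin m) → Copy H G e
copy G H e pairs i j with <-cmp i j
... | tri< i<j _ _ = matches⇒⇔ (adj? H i j) (lookup-pairs pairs i<j)
... | tri> _ _ j<i =
  let h = matches⇒⇔ (adj? H j i) (lookup-pairs pairs j<i)
  in mk⇔ (adj-sym G ∘ to h ∘ adj-sym H) (adj-sym H ∘ from h ∘ adj-sym G)
... | tri≈ _ refl _ = mk⇔ (λ a → contradiction a (adj-irrefl H i))
                          (λ a → contradiction a (adj-irrefl G (e i)))

separated : {G : Graph V} {H : Graph (Fin m)} {e : Fin m → V} → Copy H G e →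
  {True (all? λ i → all? λ j → (i ≟ j) ⊎-dec any? λ k → adj? H i k ×-dec ¬? (adj? H j k))} →
  Injective _≡_ _≡_ e
separated {G = G} {e = e} cp {sep} {i} {j} ei≡ej with toWitness sep i j
... | inj₁ i≡j             = i≡j
... | inj₂ (k , i~k , j≁k) =
  contradiction (from (cp j k) (subst (λ v → Adj G v (e k)) ei≡ej (to (cp i k) i~k))) j≁k

relabel : (G : Graph V) (H : Graph (Fin m)) {e : Fin m → V} (σ : Fin m → Fin m) →
  {True (all? λ i → all? λ j → adj? H i j →-dec adj? H (σ i) (σ j))} →
  {True (all? λ i → all? λ j → adj? H (σ i) (σ j) →-dec adj? H i j)} →
  Copy H G e → Copy H G (e ∘ σ)
relabel G H σ {pres} {reflects} cp i j =
  mk⇔ (to (cp (σ i) (σ j)) ∘ toWitness pres i j) (toWitness reflects i j ∘ from (cp (σ i) (σ j)))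

-- A positive form of `2K₂`-freeness; the hypotheses already force the four vertices to be distinct.
Bridged : Graph V → Set
Bridged G = ∀ {a b c d} → a ~ b → c ~ d → ¬ a ~ c → ¬ a ~ d → ¬ b ~ c → b ~ d
  where _~_ = Adj G

-- Diamond-freeness in a familiar form: every edge lies in just one maximal clique.
Clustered : Graph V → Set
Clustered G = ∀ {p q r s} → p ~ q → p ~ r → q ~ r → p ~ s → q ~ s → r ≢ s → r ~ s
  where _~_ = Adj G

2K₂-free⇒bridged : (G : Graph V) → ¬ InducedCopy 2K₂ G → Bridged G
2K₂-free⇒bridged {V} G free {a} {b} {c} {d} ab cd ac ad bc with adj? G b d
... | yes bd = bd
... | no  bd = contradiction induced free
  where
  H : Graph (Fin 4)
  H = induce (splitAt 2) 2K₂

  e : Fin 4 → V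
  e = lookup (a ∷ b ∷ c ∷ d ∷ [])

  cp : Copy H G e
  cp = copy G H e ((ab ∷ ac ∷ ad ∷ []) ∷ (bc ∷ bd ∷ []) ∷ (cd ∷ []) ∷ [] ∷ [])

  induced : InducedCopy 2K₂ G
  induced = record
    { embed = e ∘ join 2 2
    ; embed-injective = λ {x} {y} eq →
        trans (sym (splitAt-join 2 2 x))
          (trans (cong (splitAt 2) (separated {G = G} {H = H} cp {_} {join 2 2 x} {join 2 2 y} eq))
            (splitAt-join 2 2 y))
    ; embed-adj = λ x y →
        subst₂ (λ x′ y′ → Adj 2K₂ x′ y′ ⇔ Adj G (e (join 2 2 x)) (e (join 2 2 y)))
          (splitAt-join 2 2 x) (splitAt-join 2 2 y) (cp (join 2 2 x) (join 2 2 y))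
    }

diamond-free⇒clustered : (G : Graph V) → ¬ InducedCopy diamond G → Clustered G
diamond-free⇒clustered {V} G free {p} {q} {r} {s} pq pr qr ps qs r≢s with adj? G r s
... | yes rs = rs
... | no  rs = contradiction induced free
  where
  e : Fin 4 → V
  e = lookup (r ∷ s ∷ p ∷ q ∷ [])

  cp : Copy diamond G e
  cp = copy G diamond e
    ((rs ∷ adj-sym G pr ∷ adj-sym G qr ∷ []) ∷ (adj-sym G ps ∷ adj-sym G qs ∷ []) ∷
     (pq ∷ []) ∷ [] ∷ [])

  -- The ends 0 and 1 of the deleted edge have the same neighbours, so that pair is left to `r≢s`.
  separate : ∀ i j → i ≡ j ⊎ (i ≡ # 0 × j ≡ # 1 ⊎ i ≡ # 1 × j ≡ # 0) ⊎
                     ∃[ k ] Adj diamond i k × ¬ Adj diamond j k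
  separate = from-yes (all? λ i → all? λ j → (i ≟ j) ⊎-dec
    (((i ≟ # 0) ×-dec (j ≟ # 1)) ⊎-dec ((i ≟ # 1) ×-dec (j ≟ # 0))) ⊎-dec
    any? λ k → adj? diamond i k ×-dec ¬? (adj? diamond j k))

  injective : ∀ {i j} → e i ≡ e j → i ≡ j
  injective {i} {j} eq with separate i j
  ... | inj₁ i≡j                             = i≡j
  ... | inj₂ (inj₁ (inj₁ (refl , refl)))     = contradiction eq r≢s
  ... | inj₂ (inj₁ (inj₂ (refl , refl)))     = contradiction (sym eq) r≢s
  ... | inj₂ (inj₂ (k , i~k , j≁k))          =
    contradiction (from (cp j k) (subst (λ v → Adj G v (e k)) eq (to (cp i k) i~k))) j≁k

  induced : InducedCopy diamond G
  induced = record { embed = e ; embed-injective = injective ; embed-adj = cp }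

Irreducible : Graph V → Set
Irreducible G = ∀ {u v} → u ≢ v → ∃[ w ] Adj G u w × ¬ Adj G v w

Incomplete : Graph V → Set
Incomplete G = ∃₂ λ u v → u ≢ v × ¬ Adj G u v

UniqueThird : Graph V → Set
UniqueThird G = ∀ {p q r s} → p ~ q → p ~ r → q ~ r → p ~ s → q ~ s → r ≡ s
  where _~_ = Adj G

module _ (G : Graph (Fin n)) (bridge : Bridged G) (irr : Irreducible G) where

  private
    infix 4 _~_
    _~_ = Adj G
    ~-sym : ∀ {u v} → u ~ v → v ~ u
    ~-sym = adj-sym G
    ≁-sym : ∀ {u v} → ¬ u ~ v → ¬ v ~ u
    ≁-sym u≁v = u≁v ∘ ~-sym

  clash : ∀ {a b c d} → a ~ b → c ~ d → ¬ a ~ c → ¬ a ~ d → ¬ b ~ c → ¬ b ~ d → ⊥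
  clash ab cd ac ad bc bd = bd (bridge ab cd ac ad bc)

  -- Irreducible graphs containing `K₄`

  module _ (clustered : Clustered G) {e : Fin 4 → Fin n} (K₄ : Copy (complete 4) G e) where
    private
      Near : (u v : Fin n) → Set
      Near u v = u ≡ v ⊎ u ~ v

      near? : ∀ u v → Dec (Near u v)
      near? u v = (u ≟ v) ⊎-dec adj? G u v

      closure : ∀ {x y z t} → x ~ y → z ~ x → z ~ y → Near t x → Near t y → Near t z
      closure xy zx zy (inj₁ refl) _ = inj₂ (~-sym zx)
      closure xy zx zy (inj₂ _) (inj₁ refl) = inj₂ (~-sym zy)
      closure {z = z} {t} xy zx zy (inj₂ tx) (inj₂ ty) with t ≟ z
      ... | yes t≡z = inj₁ t≡z
      ... | no t≢z  = inj₂ (clustered xy (~-sym tx) (~-sym ty) (~-sym zx) (~-sym zy) t≢z)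

      Full : Fin n → Set
      Full t = ∀ i → Near t (e i)

      full : ∀ {t i j} → i ≢ j → Near t (e i) → Near t (e j) → Full t
      full {i = i} {j} i≢j ti tj k with k ≟ i | k ≟ j
      ... | yes refl | _        = ti
      ... | no _     | yes refl = tj
      ... | no k≢i   | no k≢j   = closure (to (K₄ i j) i≢j) (to (K₄ k i) k≢i) (to (K₄ k j) k≢j) ti tj

      full-near : ∀ {t w} → Full t → Full w → Near t w
      full-near {t} {w} ft fw with ft (# 0) | ft (# 1) | fw (# 0) | fw (# 1)
      ... | inj₁ refl | _         | w₀        | _         = Sum.map sym ~-sym w₀
      ... | inj₂ _    | inj₁ refl | _         | w₁        = Sum.map sym ~-sym w₁
      ... | t₀        | t₁        | inj₁ refl | _         = t₀
      ... | t₀        | t₁        | inj₂ _    | inj₁ refl = t₁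
      ... | t₀        | t₁        | inj₂ w₀   | inj₂ w₁   =
        closure (to (K₄ (# 0) (# 1)) λ ()) w₀ w₁ t₀ t₁

      sole : ∀ {t} → ¬ Full t → ∃[ i ] (∀ k → i ≢ k → ¬ Near t (e k))
      sole {t} ¬full with any? (λ i → near? t (e i))
      ... | yes (i , ti) = i , λ k i≢k tk → ¬full (full i≢k ti tk)
      ... | no none      = # 0 , λ k _ tk → none (k , tk)

      two-others : ∀ (i j : Fin 4) →
        ∃₂ λ k l → k ≢ l × (i ≢ k × i ≢ l) × (j ≢ k × j ≢ l)
      two-others = from-yes (all? {4} λ i → all? {4} λ j → any? {4} λ k → any? {4} λ l →
        ¬? (k ≟ l) ×-dec (¬? (i ≟ k) ×-dec ¬? (i ≟ l)) ×-dec (¬? (j ≟ k) ×-dec ¬? (j ≟ l)))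

      full? : ∀ t → Dec (Full t)
      full? t = all? λ i → near? t (e i)

      -- Two adjacent vertices that are not full leave an edge of K₄ unseen.
      neighbour-full : ∀ {t w} → ¬ Full t → t ~ w → Full w
      neighbour-full {t} {w} ¬ft tw with full? w
      ... | yes fw = fw
      ... | no ¬fw =
        let i , ti = sole ¬ft ; j , wj = sole ¬fw
            k , l , k≢l , (i≢k , i≢l) , (j≢k , j≢l) = two-others i j
        in ⊥-elim (clash tw (to (K₄ k l) k≢l)
             (ti k i≢k ∘ inj₂) (ti l i≢l ∘ inj₂) (wj k j≢k ∘ inj₂) (wj l j≢l ∘ inj₂))

      -- If `t` is not full, its neighbours all are, hence each equals `e k` or sees it. A neighbour
      -- separating `t` from `e k` must then be `e k` itself.
      all-full : ∀ t → Full t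
      all-full t k with t ≟ e k
      ... | yes t≡ek = inj₁ t≡ek
      ... | no t≢ek with full? t
      ...   | yes ft = ft k
      ...   | no ¬ft with irr t≢ek
      ...     | w , tw , ek≁w with neighbour-full ¬ft tw k
      ...       | inj₁ refl = inj₂ tw
      ...       | inj₂ w~ek = contradiction (~-sym w~ek) ek≁w

    K₄-complete : ∀ {u v} → u ≢ v → u ~ v
    K₄-complete u≢v with full-near (all-full _) (all-full _)
    ... | inj₁ u≡v = contradiction u≡v u≢v
    ... | inj₂ uv  = uv

  unique-third : Clustered G → Incomplete G → UniqueThird G
  unique-third clustered (u , v , u≢v , u≁v) {p} {q} {r} {s} pq pr qr ps qs with r ≟ s
  ... | yes r≡s = r≡s
  ... | no r≢s = contradiction (K₄-complete clustered K₄ u≢v) u≁v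
    where
    K₄ : Copy (complete 4) G (lookup (p ∷ q ∷ r ∷ s ∷ []))
    K₄ = copy G (complete 4) (lookup (p ∷ q ∷ r ∷ s ∷ []))
      ((pq ∷ pr ∷ ps ∷ []) ∷ (qr ∷ qs ∷ []) ∷ (clustered pq pr qr ps qs r≢s ∷ []) ∷ [] ∷ [])

  Onto : (Fin m → Fin n) → Set
  Onto e = ∀ v → ∃[ i ] e i ≡ v

  onto : {e : Fin m → Fin n} → (∀ t → ¬ (∀ i → t ≢ e i)) → Onto e
  onto {e = e} none t with any? (λ i → e i ≟ t)
  ... | yes p = p
  ... | no ¬p = contradiction (λ i t≡ei → ¬p (i , sym t≡ei)) (none t)

  module _ (H : Graph (Fin m)) {e : Fin m → Fin n} (K : Copy H G e) where
    edge : ∀ i j {_ : True (adj? H i j)} → e i ~ e j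
    edge i j {ij} = to (K i j) (toWitness ij)

    nonedge : ∀ i j {_ : False (adj? H i j)} → ¬ e i ~ e j
    nonedge i j {ij} = toWitnessFalse ij ∘ from (K i j)

  -- Irreducible graphs with a triangle: the prism and `C₉`

  module _ (third : UniqueThird G) where

    record Triangle (p q r : Fin n) : Set where
      constructor triangle
      field
        pq : p ~ q
        qr : q ~ r
        pr : p ~ r

    rotate : ∀ {p q r} → Triangle p q r → Triangle q r p
    rotate (triangle pq qr pr) = triangle qr (~-sym pr) (~-sym pq)

    flip : ∀ {p q r} → Triangle p q r → Triangle p r q
    flip (triangle pq qr pr) = triangle pr (~-sym qr) pq

    Hangs : (t p q r : Fin n) → Set
    Hangs t p q r = t ~ p × ¬ t ~ q × ¬ t ~ r

    flipʰ : ∀ {t p q r} → Hangs t p q r → Hangs t p r q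
    flipʰ (tp , tq , tr) = tp , tr , tq

    hangs : ∀ {p q r t} → Triangle p q r → t ≢ q → t ≢ r → t ~ p → Hangs t p q r
    hangs (triangle pq qr pr) t≢q t≢r tp =
      tp , (λ tq → t≢r (sym (third pq pr qr (~-sym tp) (~-sym tq)))) ,
           (λ tr → t≢q (sym (third pr pq (~-sym qr) (~-sym tp) (~-sym tr))))

    -- Two corners would give the edge between them a second triangle. If `t` missed all corners, a
    -- neighbour `s` of `t` not seeing `p` would see `q` and `r`, hence be `p`, which `t` misses.
    attach : ∀ {p q r t} → Triangle p q r → t ≢ p → t ≢ q → t ≢ r →
             Hangs t p q r ⊎ Hangs t q r p ⊎ Hangs t r p q
    attach {p} {q} {r} {t} T@(triangle pq qr pr) t≢p t≢q t≢r
      with adj? G t p | adj? G t q | adj? G t r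
    ... | yes tp | _      | _      = inj₁ (hangs T t≢q t≢r tp)
    ... | no _   | yes tq | _      = inj₂ (inj₁ (hangs (rotate T) t≢r t≢p tq))
    ... | no _   | no _   | yes tr = inj₂ (inj₂ (hangs (rotate (rotate T)) t≢p t≢q tr))
    ... | no tp  | no tq  | no tr  =
      let s , ts , ps = irr t≢p
          sr = bridge ts pr tp tr (≁-sym ps)
          sq = bridge ts pq tp tq (≁-sym ps)
          s≡p = third qr (~-sym sq) (~-sym sr) (~-sym pq) (~-sym pr)
      in contradiction (subst (t ~_) s≡p ts) tp

    not-twice : ∀ {p q r t s} → Triangle p q r → Hangs t p q r → Hangs s p q r → ¬ t ~ s
    not-twice (triangle _ qr _) (_ , tq , tr) (_ , sq , sr) ts = clash ts qr tq tr sq sr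

    -- Take a neighbour `s` of `t` missing `q`: the edge `q r` forces `s ~ r`, and `s ~ p` would
    -- identify `s` with `q`.
    reach : ∀ {p q r t} → Triangle p q r → Hangs t p q r → ∃[ s ] t ~ s × Hangs s r p q
    reach {p} {q} {r} {t} (triangle pq qr pr) (tp , tq , tr) =
      let s , ts , qs = irr {t} {q} λ { refl → tr qr }
          sr = bridge ts qr tq tr (≁-sym qs)
      in s , ts , sr ,
         (λ sp → tq (subst (t ~_) (sym (third pr pq (~-sym qr) (~-sym sp) (~-sym sr))) ts)) ,
         ≁-sym qs

    -- The neighbours `b` and `c` reached from `a` may fail to be adjacent. Then `b` reaches some
    -- `c′` and `c` some `b′`; either one of these closes a triangle at `a`, or the edge `b′ c′`
    -- forms a `2K₂` with `a p`.
    prism : ∀ {p q r a} → Triangle p q r → Hangs a p q r →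
            ∃₂ λ b c → Hangs b q r p × Hangs c r p q × Triangle a b c
    prism {p} {q} {r} {a} T ha with reach T ha | reach (flip T) (flipʰ ha)
    ... | c , ac , hc | b , ab , hb with adj? G b c
    ...   | yes bc = b , c , flipʰ hb , hc , triangle ab bc ac
    ...   | no b≁c with reach (flip (rotate T)) hb | reach (rotate (rotate T)) hc
    ...     | c′ , bc′ , hc′ | b′ , cb′ , hb′ with adj? G a c′ | adj? G a b′
    ...       | yes ac′ | _       = b , c′ , flipʰ hb , flipʰ hc′ , triangle ab bc′ ac′
    ...       | no _    | yes ab′ = b′ , c , hb′ , hc , triangle ab′ (~-sym cb′) ac
    ...       | no a≁c′ | no a≁b′ = ⊥-elim
      (clash b′c′ (proj₁ ha) (≁-sym a≁b′) (proj₂ (proj₂ hb′)) (≁-sym a≁c′) (proj₂ (proj₂ hc′)))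
      where
      b′c′ : b′ ~ c′
      b′c′ = ~-sym (bridge bc′ cb′ b≁c (not-twice (rotate T) (flipʰ hb) hb′)
               (not-twice (rotate (rotate T)) (flipʰ hc′) hc))

    prism-copy : ∀ {p q r a b c} → Triangle p q r → Triangle a b c →
      Hangs a p q r → Hangs b q r p → Hangs c r p q →
      Copy C₆ G (lookup (p ∷ c ∷ q ∷ a ∷ r ∷ b ∷ []))
    prism-copy (triangle pq qr pr) (triangle ab bc ac)
               (ap , aq , ar) (bq , br , bp) (cr , cp , cq) =
      copy G C₆ _
        ((≁-sym cp ∷ pq ∷ ~-sym ap ∷ pr ∷ ≁-sym bp ∷ []) ∷
         (cq ∷ ~-sym ac ∷ cr ∷ ~-sym bc ∷ []) ∷
         (≁-sym aq ∷ qr ∷ ~-sym bq ∷ []) ∷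
         (ar ∷ ab ∷ []) ∷
         (≁-sym br ∷ []) ∷ [] ∷ [])

    -- C₉ is three triangles pqr, abc, xyz, any two of them forming a prism.
    enneagon-copy : ∀ {e t} → Copy C₆ G e → (∀ i → t ≢ e i) →
      Hangs t (e (# 0)) (e (# 2)) (e (# 4)) → Hangs t (e (# 5)) (e (# 1)) (e (# 3)) →
      ∃ (Copy C₉ G)
    enneagon-copy {e} {x} K new hx@(xp , xq , xr) (xb , xc , xa) = result
      where
      p = e (# 0); q = e (# 2); r = e (# 4)
      a = e (# 3); b = e (# 5); c = e (# 1)

      E  = edge C₆ K
      ¬E = nonedge C₆ K

      T₁ : Triangle p q r
      T₁ = triangle (E (# 0) (# 2)) (E (# 2) (# 4)) (E (# 0) (# 4))

      T₂ : Triangle a b c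
      T₂ = triangle (E (# 3) (# 5)) (E (# 5) (# 1)) (E (# 3) (# 1))

      -- The matching `a p`, `b q`, `c r` of the prism forces a shifted one, `b x`, `c y`, `a z`, on
      -- the new triangle. Any other corner is taken by an equality or leaves a `2K₂`.
      third-corner : ∃[ z ] x ~ z × Hangs z r p q × Hangs z a b c
      third-corner with reach T₁ hx
      ... | z , xz , hz@(zr , zp , zq)
        with attach T₂ (λ { refl → zp (E (# 3) (# 0)) }) (λ { refl → zq (E (# 5) (# 2)) })
                       (λ { refl → xc xz })
      ...   | inj₁ za                      = z , xz , hz , za
      ...   | inj₂ (inj₁ (_ , zc , za))   =
        ⊥-elim (clash xz (E (# 3) (# 1)) xa xc za zc)
      ...   | inj₂ (inj₂ (_ , za , zb))   =
        ⊥-elim (clash zr (E (# 3) (# 5)) za zb (¬E (# 4) (# 3)) (¬E (# 4) (# 5)))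

      second-corner : ∀ {z} → Hangs z r p q → Hangs z a b c →
                      ∃[ y ] z ~ y × Hangs y q r p × Hangs y c a b
      second-corner {z} hz (_ , zb , zc) with reach (rotate (rotate T₁)) hz
      ... | y , zy , hy@(yq , yr , yp)
        with attach T₂ (λ { refl → yp (E (# 3) (# 0)) }) (λ { refl → zb zy })
                       (λ { refl → yr (E (# 1) (# 4)) })
      ...   | inj₁ (_ , yb , yc)           =
        ⊥-elim (clash zy (E (# 5) (# 1)) zb zc yb yc)
      ...   | inj₂ (inj₁ (_ , yc , ya))   =
        ⊥-elim (clash yq (E (# 3) (# 1)) ya yc (¬E (# 2) (# 3)) (¬E (# 2) (# 1)))
      ...   | inj₂ (inj₂ hyc)              = y , zy , hy , hyc

      result : ∃ (Copy C₉ G)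
      result =
        let z , xz , hz@(zr , zp , zq) , hza@(za , zb , zc) = third-corner
            y , zy , (yq , yr , yp) , (yc , ya , yb) = second-corner hz hza
            xy = bridge (~-sym xp) (~-sym yc) (¬E (# 0) (# 1)) (≁-sym yp) xc
        in lookup (p ∷ a ∷ z ∷ r ∷ c ∷ y ∷ q ∷ b ∷ x ∷ []) , copy G C₉ _
          ((E (# 0) (# 3) ∷ ≁-sym zp ∷ E (# 0) (# 4) ∷ ¬E (# 0) (# 1) ∷ ≁-sym yp ∷
            E (# 0) (# 2) ∷ ¬E (# 0) (# 5) ∷ ~-sym xp ∷ []) ∷
           (~-sym za ∷ ¬E (# 3) (# 4) ∷ E (# 3) (# 1) ∷ ≁-sym ya ∷ ¬E (# 3) (# 2) ∷
            E (# 3) (# 5) ∷ ≁-sym xa ∷ []) ∷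
           (zr ∷ zc ∷ zy ∷ zq ∷ zb ∷ ~-sym xz ∷ []) ∷
           (E (# 4) (# 1) ∷ ≁-sym yr ∷ E (# 4) (# 2) ∷ ¬E (# 4) (# 5) ∷ ≁-sym xr ∷ []) ∷
           (~-sym yc ∷ ¬E (# 1) (# 2) ∷ E (# 1) (# 5) ∷ ≁-sym xc ∷ []) ∷
           (yq ∷ yb ∷ ~-sym xy ∷ []) ∷
           (E (# 2) (# 5) ∷ ≁-sym xq ∷ []) ∷
           (~-sym xb ∷ []) ∷ [] ∷ [])

    -- By rotation `t` hangs at 0. In the other triangle the partner 3 of 0 would leave a `2K₂`, and
    -- a reflection exchanges the two remaining corners.
    prism-extends : ∀ {e t} → Copy C₆ G e → (∀ i → t ≢ e i) → ∃ (Copy C₉ G)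
    prism-extends {e} {t} K new =
      case attach T₁ (new (# 0)) (new (# 2)) (new (# 4)) of λ where
        (inj₁ h)        → from-first K new h
        (inj₂ (inj₁ h)) → from-first (relabel G C₆ (turn 2) K) (λ i → new (turn 2 i)) h
        (inj₂ (inj₂ h)) → from-first (relabel G C₆ (turn 4) K) (λ i → new (turn 4 i)) h
      where
      turn : ℕ → Fin 6 → Fin 6
      turn s i = (toℕ i + s) mod 6

      mirror : Fin 6 → Fin 6
      -- `5` stands for -1: this fixes 0 and 3 and exchanges 1 with 5 and 2 with 4.
      mirror i = (5 * toℕ i) mod 6

      T₁ : Triangle (e (# 0)) (e (# 2)) (e (# 4))
      T₁ = triangle (edge C₆ K (# 0) (# 2)) (edge C₆ K (# 2) (# 4)) (edge C₆ K (# 0) (# 4))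

      from-first : ∀ {e} → Copy C₆ G e → (∀ i → t ≢ e i) →
                   Hangs t (e (# 0)) (e (# 2)) (e (# 4)) → ∃ (Copy C₉ G)
      from-first {e} K new h@(tp , _ , _) =
        case attach T₂ (new (# 3)) (new (# 5)) (new (# 1)) of λ where
          (inj₁ (_ , tb , tc)) →
            ⊥-elim (clash tp (edge C₆ K (# 5) (# 1)) tb tc
                      (nonedge C₆ K (# 0) (# 5)) (nonedge C₆ K (# 0) (# 1)))
          (inj₂ (inj₁ hb)) → enneagon-copy K new h hb
          (inj₂ (inj₂ hc)) →
            enneagon-copy (relabel G C₆ mirror K) (λ i → new (mirror i)) (flipʰ h) (flipʰ hc)
        where
        T₂ : Triangle (e (# 3)) (e (# 5)) (e (# 1))
        T₂ = triangle (edge C₆ K (# 3) (# 5)) (edge C₆ K (# 5) (# 1)) (edge C₆ K (# 3) (# 1))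

    -- By rotation `t` hangs at 0, and 1 is excluded as before. Hanging at 7, it sees 5 and 2 and so
    -- is their third vertex 8; hanging at 4, both seeing and missing 8 lead to a `2K₂`.
    enneagon-onto : ∀ {e} → Copy C₉ G e → Onto e
    enneagon-onto {e} K = onto λ t new →
      case attach T₁ (new (# 0)) (new (# 6)) (new (# 3)) of λ where
        (inj₁ h)        → from-first K new h
        (inj₂ (inj₁ h)) → from-first (relabel G C₉ (turn 6) K) (λ i → new (turn 6 i)) h
        (inj₂ (inj₂ h)) → from-first (relabel G C₉ (turn 3) K) (λ i → new (turn 3 i)) h
      where
      turn : ℕ → Fin 9 → Fin 9
      turn s i = (toℕ i + s) mod 9

      T₁ : Triangle (e (# 0)) (e (# 6)) (e (# 3))
      T₁ = triangle (edge C₉ K (# 0) (# 6)) (edge C₉ K (# 6) (# 3)) (edge C₉ K (# 0) (# 3))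

      from-first : ∀ {e t} → Copy C₉ G e → (∀ i → t ≢ e i) →
                   ¬ Hangs t (e (# 0)) (e (# 6)) (e (# 3))
      from-first {e} {t} K new (tp , tq , tr) =
        case attach T₂ (new (# 1)) (new (# 7)) (new (# 4)) of λ where
          (inj₁ (_ , tb , tc)) → clash tp (E (# 7) (# 4)) tb tc (¬E (# 0) (# 7)) (¬E (# 0) (# 4))
          (inj₂ (inj₁ (tb , tc , ta))) →
            let ty = bridge (~-sym tp) (E (# 4) (# 5)) (¬E (# 0) (# 4)) (¬E (# 0) (# 5)) tc
                tz = bridge (~-sym tb) (E (# 3) (# 2)) (¬E (# 7) (# 3)) (¬E (# 7) (# 2)) tr
            in new (# 8) (third (E (# 5) (# 2)) (~-sym ty) (~-sym tz) (E (# 5) (# 8)) (E (# 2) (# 8)))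
          (inj₂ (inj₂ (tc , ta , tb))) →
            let tx = λ tx → clash tx (E (# 6) (# 3)) tq tr (¬E (# 8) (# 6)) (¬E (# 8) (# 3))
                tz = bridge (~-sym tc) (E (# 8) (# 2)) (¬E (# 4) (# 8)) (¬E (# 4) (# 2)) tx
            in clash tz (E (# 6) (# 7)) tq tb (¬E (# 2) (# 6)) (¬E (# 2) (# 7))
        where
        E  = edge C₉ K
        ¬E = nonedge C₉ K

        T₂ : Triangle (e (# 1)) (e (# 7)) (e (# 4))
        T₂ = triangle (E (# 1) (# 7)) (E (# 7) (# 4)) (E (# 1) (# 4))

    triangle-shape : ∀ {p q r} → Triangle p q r → Incomplete G →
      (∃[ e ] Copy C₆ G e × Onto e) ⊎ (∃[ e ] Copy C₉ G e × Onto e)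
    triangle-shape {p} {q} {r} T@(triangle pq qr pr) (u , v , u≢v , u≁v) =
      let a , a≢p , a≢q , a≢r = outside
      in case attach T a≢p a≢q a≢r of λ where
           (inj₁ h)        → from-prism T h
           (inj₂ (inj₁ h)) → from-prism (rotate T) h
           (inj₂ (inj₂ h)) → from-prism (rotate (rotate T)) h
      where
      corner? : ∀ t → (t ≡ p ⊎ t ≡ q ⊎ t ≡ r) ⊎ (t ≢ p × t ≢ q × t ≢ r)
      corner? t with t ≟ p | t ≟ q | t ≟ r
      ... | yes t≡p | _       | _       = inj₁ (inj₁ t≡p)
      ... | no _    | yes t≡q | _       = inj₁ (inj₂ (inj₁ t≡q))
      ... | no _    | no _    | yes t≡r = inj₁ (inj₂ (inj₂ t≡r))
      ... | no t≢p  | no t≢q  | no t≢r  = inj₂ (t≢p , t≢q , t≢r)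

      outside : ∃[ t ] t ≢ p × t ≢ q × t ≢ r
      outside with corner? u | corner? v
      ... | inj₂ out | _        = u , out
      ... | inj₁ _   | inj₂ out = v , out
      ... | inj₁ (inj₁ refl)        | inj₁ (inj₁ refl)        = contradiction refl u≢v
      ... | inj₁ (inj₁ refl)        | inj₁ (inj₂ (inj₁ refl)) = contradiction pq u≁v
      ... | inj₁ (inj₁ refl)        | inj₁ (inj₂ (inj₂ refl)) = contradiction pr u≁v
      ... | inj₁ (inj₂ (inj₁ refl)) | inj₁ (inj₁ refl)        = contradiction (~-sym pq) u≁v
      ... | inj₁ (inj₂ (inj₁ refl)) | inj₁ (inj₂ (inj₁ refl)) = contradiction refl u≢v
      ... | inj₁ (inj₂ (inj₁ refl)) | inj₁ (inj₂ (inj₂ refl)) = contradiction qr u≁v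
      ... | inj₁ (inj₂ (inj₂ refl)) | inj₁ (inj₁ refl)        = contradiction (~-sym pr) u≁v
      ... | inj₁ (inj₂ (inj₂ refl)) | inj₁ (inj₂ (inj₁ refl)) = contradiction (~-sym qr) u≁v
      ... | inj₁ (inj₂ (inj₂ refl)) | inj₁ (inj₂ (inj₂ refl)) = contradiction refl u≢v

      from-prism : ∀ {p q r a} → Triangle p q r → Hangs a p q r →
        (∃[ e ] Copy C₆ G e × Onto e) ⊎ (∃[ e ] Copy C₉ G e × Onto e)
      from-prism {p} {q} {r} {a} T ha with prism T ha
      ... | b , c , hb , hc , T′
        with all? (λ v → any? λ i → lookup (p ∷ c ∷ q ∷ a ∷ r ∷ b ∷ []) i ≟ v)
      ...   | yes covered = inj₁ (_ , prism-copy T T′ ha hb hc , covered)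
      ...   | no ¬covered =
        let v , missed = ¬∀⟶∃¬ n _ (λ v → any? λ i → _ ≟ v) ¬covered
            e , K = prism-extends (prism-copy T T′ ha hb hc) (λ i v≡ei → missed (i , sym v≡ei))
        in inj₂ (e , K , enneagon-onto K)

  -- Irreducible triangle-free graphs: the pentagon

  module _ (triangle-free : ∀ {p q r} → p ~ q → q ~ r → ¬ p ~ r) where

    private
      turn : Fin 5 → Fin 5 → Fin 5
      turn s i = (toℕ i + toℕ s) mod 5

      turn-zero : ∀ s → turn s zero ≡ s
      turn-zero = from-yes (all? λ s → turn s zero ≟ s)

      turn-copy : ∀ s {e : Fin 5 → Fin n} → Copy C₅ G e → Copy C₅ G (e ∘ turn s)
      turn-copy s K i j =
        mk⇔ (to (K _ _) ∘ proj₁ (turn-adj s i j)) (proj₂ (turn-adj s i j) ∘ from (K _ _))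
        where
        turn-adj : ∀ s i j → (Adj C₅ i j → Adj C₅ (turn s i) (turn s j)) ×
                             (Adj C₅ (turn s i) (turn s j) → Adj C₅ i j)
        turn-adj = from-yes (all? λ s → all? λ i → all? λ j →
          (adj? C₅ i j →-dec adj? C₅ (turn s i) (turn s j)) ×-dec
          (adj? C₅ (turn s i) (turn s j) →-dec adj? C₅ i j))

    pentagon-copy : Incomplete G → ∃ (Copy C₅ G)
    pentagon-copy (u , v , u≢v , u≁v) =
      let a , ua , va = irr u≢v
          b , vb , ub = irr (≢-sym u≢v)
          ab = bridge ua vb u≁v ub (≁-sym va)
          w , uw , bw = irr {u} {b} λ u≡b → u≁v (subst (_~ v) (sym u≡b) (~-sym vb))
          wv = bridge uw (~-sym vb) ub u≁v (≁-sym bw)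
      in lookup (u ∷ a ∷ b ∷ v ∷ w ∷ []) , copy G C₅ _
        ((ua ∷ ub ∷ u≁v ∷ uw ∷ []) ∷
         (ab ∷ ≁-sym va ∷ triangle-free (~-sym ua) uw ∷ []) ∷
         (~-sym vb ∷ bw ∷ []) ∷
         (~-sym wv ∷ []) ∷ [] ∷ [])

    pentagon-onto : ∀ {e} → Copy C₅ G e → Onto e
    pentagon-onto {e} K = onto λ t new → case any? (λ i → adj? G t (e i)) of λ where
        (no none)      → isolated K new (λ i ti → none (i , ti))
        (yes (i , ti)) → attached (turn-copy i K) (new ∘ turn i)
                           (subst (λ j → t ~ e j) (sym (turn-zero i)) ti)
      where
      isolated : ∀ {e t} → Copy C₅ G e → (∀ i → t ≢ e i) → ¬ (∀ i → ¬ t ~ e i)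
      isolated {e} {t} K new none =
        let s , ts , 0s = irr (new (# 0))
            s1 = bridge ts (E (# 0) (# 1)) (none (# 0)) (none (# 1)) (≁-sym 0s)
            s4 = bridge ts (E (# 0) (# 4)) (none (# 0)) (none (# 4)) (≁-sym 0s)
        in clash ts (E (# 2) (# 3)) (none (# 2)) (none (# 3))
             (triangle-free s1 (E (# 1) (# 2))) (triangle-free s4 (E (# 4) (# 3)))
        where E = edge C₅ K

      -- `t` stands where 1 does, so some `s` sees `t` but not 1. Whether `s` sees 3 or is forced to
      -- see 4, that edge forms a `2K₂` with a cycle edge at 1.
      twin : ∀ {e t} → Copy C₅ G e → t ≢ e (# 1) → t ~ e (# 0) → ¬ t ~ e (# 2)
      twin {e} {t} K t≢1 t0 t2 with irr t≢1
      ... | s , ts , 1s = case adj? G s (e (# 3)) of λ where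
          (yes s3) → clash s3 (E (# 0) (# 1)) (triangle-free (~-sym ts) t0) (≁-sym 1s)
                       (¬E (# 3) (# 0)) (¬E (# 3) (# 1))
          (no ¬s3) →
            let s4 = bridge ts (E (# 3) (# 4)) (triangle-free t2 (E (# 2) (# 3)))
                       (triangle-free t0 (E (# 0) (# 4))) ¬s3
            in clash s4 (E (# 1) (# 2)) (≁-sym 1s) (triangle-free (~-sym ts) t2)
                 (¬E (# 4) (# 1)) (¬E (# 4) (# 2))
        where
        E  = edge C₅ K
        ¬E = nonedge C₅ K

      attached : ∀ {e t} → Copy C₅ G e → (∀ i → t ≢ e i) → ¬ t ~ e (# 0)
      attached {e} {t} K new t0 = case adj? G t (e (# 2)) of λ where
        (yes t2) → twin K (new (# 1)) t0 t2
        (no ¬t2) →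
          let t3 = bridge (~-sym t0) (edge C₅ K (# 2) (# 3)) (nonedge C₅ K (# 0) (# 2))
                     (nonedge C₅ K (# 0) (# 3)) ¬t2
          -- The rotation puts 3, 4, 0 in the places of 0, 1, 2, so `t` now doubles 4.
          in twin (turn-copy (# 3) K) (new (# 4)) t3 t0

-- Connectivity by jumps

-- Two colours alternate along a path, so a triangle or a 5-cycle needs three; with `k < ℓ` this
-- supplies the fourth colour.
alternate : k ≤ 2 → {x y z : Fin k} → x ≢ y → y ≢ z → x ≡ z
alternate k≤2 x≢y y≢z =
  inject≤-injective k≤2 k≤2 _ _ (binary (x≢y ∘ inject≤-injective k≤2 k≤2 _ _)
                                        (y≢z ∘ inject≤-injective k≤2 k≤2 _ _))
  where
  binary : {x y z : Fin 2} → x ≢ y → y ≢ z → x ≡ z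
  binary {x} {y} {z} = toWitness {a? = all? {2} λ x → all? {2} λ y → all? {2} λ z →
    ¬? (x ≟ y) →-dec (¬? (y ≟ z) →-dec (x ≟ z))} _ x y z

module _ {c : V → Fin k} {G : Graph V} (valid : Valid G c) where

  triangle⇒3≤ : ∀ {u v w} → Adj G u v → Adj G v w → Adj G u w → 3 ≤ k
  triangle⇒3≤ uv vw uw with ℕ.≤-<-connex k 2
  ... | inj₂ 2<k = 2<k
  ... | inj₁ k≤2 = contradiction (alternate k≤2 (valid _ _ uv) (valid _ _ vw)) (valid _ _ uw)

  pentagon⇒3≤ : ∀ {u v w x y} → Adj G u v → Adj G v w → Adj G w x → Adj G x y → Adj G u y → 3 ≤ k
  pentagon⇒3≤ uv vw wx xy uy with ℕ.≤-<-connex k 2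
  ... | inj₂ 2<k = 2<k
  ... | inj₁ k≤2 = contradiction
    (trans (alternate k≤2 (valid _ _ uv) (valid _ _ vw))
           (alternate k≤2 (valid _ _ wx) (valid _ _ xy)))
    (valid _ _ uy)

module _ (G : Graph (Fin n)) (bridge : Bridged G) (clustered : Clustered G)
         {c₀ : Fin n → Fin k} (valid : Valid G c₀) (k<ℓ : k < ℓ) where

  copy-connected : (H : Graph (Fin m)) {e : Fin m → Fin n} → Copy H G e → Injective _≡_ _≡_ e →
    (∀ v → ∃[ i ] e i ≡ v) → JumpConnected H ℓ (m * 2) → JumpConnected G ℓ (n * 2)
  copy-connected H {e} K e-injective onto conn vc vd =
    pad vc (transfer {G = G} {H = H} {f = f} {g = e} homf (to (K _ _)) (proj₂ ∘ onto) conn vc vd)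
      (ℕ.*-monoˡ-≤ 2 (injective⇒≤ {f = e} e-injective))
    where
    f = proj₁ ∘ onto

    homf : Hom G H f
    homf {u} {v} uv =
      from (K _ _) (subst₂ (Adj G) (sym (proj₂ (onto u))) (sym (proj₂ (onto v))) uv)

  irreducible-connected : Irreducible G → JumpConnected G ℓ (n * 2)
  irreducible-connected irr with any? (λ u → any? λ v → ¬? (u ≟ v) ×-dec ¬? (adj? G u v))
  ... | no all-adjacent =
    transfer {G = G} {H = complete n} {f = id} {g = id} distinct (joined _ _) (λ _ → refl)
      (complete-connected (ℕ.≤-<-trans (injective⇒≤ {f = c₀} c₀-injective) k<ℓ))
    where
    joined : ∀ u v → u ≢ v → Adj G u v
    joined u v u≢v = decidable-stable (adj? G u v) λ u≁v → all-adjacent (u , v , u≢v , u≁v)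

    distinct : ∀ {u v} → Adj G u v → u ≢ v
    distinct {u} uv refl = adj-irrefl G u uv

    c₀-injective : Injective _≡_ _≡_ c₀
    c₀-injective {u} {v} eq = decidable-stable (u ≟ v) λ u≢v → valid u v (joined u v u≢v) eq
  ... | yes incomplete
    with any? (λ p → any? λ q → any? λ r → adj? G p q ×-dec adj? G q r ×-dec adj? G p r)
  ...   | yes (_ , _ , _ , pq , qr , pr)
    with triangle-shape G bridge irr (unique-third G bridge irr clustered incomplete)
           (triangle pq qr pr) incomplete
  ...     | inj₁ (_ , K , onto) =
    copy-connected C₆ K (separated {G = G} {H = C₆} K) onto
      (C₆-connected (ℕ.≤-trans (s≤s (triangle⇒3≤ {G = G} valid pq qr pr)) k<ℓ))
  ...     | inj₂ (_ , K , onto) =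
    copy-connected C₉ K (separated {G = G} {H = C₉} K) onto
      (C₉-connected (ℕ.≤-trans (s≤s (triangle⇒3≤ {G = G} valid pq qr pr)) k<ℓ))
  irreducible-connected irr | yes incomplete | no no-triangle =
    let triangle-free = λ {p} {q} {r} pq qr pr → no-triangle (p , q , r , pq , qr , pr)
        e , K = pentagon-copy G bridge irr triangle-free incomplete
        E = edge G bridge irr C₅ K
        3≤k = pentagon⇒3≤ {G = G} valid (E (# 0) (# 1)) (E (# 1) (# 2)) (E (# 2) (# 3))
                (E (# 3) (# 4)) (E (# 0) (# 4))
    in copy-connected C₅ K (separated {G = G} {H = C₅} K)
         (pentagon-onto G bridge irr triangle-free K) (C₅-connected (ℕ.≤-trans (s≤s 3≤k) k<ℓ))

-- A fixed `k`-colouring with `k < ℓ` is carried along because it restricts to `G` minus a vertex,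
-- as do `Bridged` and `Clustered`. The bound is written `n * 2` so that `suc n * 2` reduces to
-- `2 + n * 2`, the price in `remove-dominated`.
jump-connected : (G : Graph (Fin n)) → Bridged G → Clustered G →
  {c₀ : Fin n → Fin k} → Valid G c₀ → k < ℓ → JumpConnected G ℓ (n * 2)
jump-connected {zero} G bridge clustered valid k<ℓ =
  irreducible-connected G bridge clustered valid k<ℓ λ { {()} }
jump-connected {suc n} G bridge clustered valid k<ℓ
  with any? (λ u → any? λ v → ¬? (u ≟ v) ×-dec all? λ w → adj? G u w →-dec adj? G v w)
... | yes (u , v , u≢v , N⊆) = remove-dominated G u≢v N⊆
  (jump-connected (induce (punchIn u) G) bridge
    (λ pq pr qr ps qs r≢s → clustered pq pr qr ps qs (r≢s ∘ punchIn-injective u _ _))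
    (λ _ _ → valid _ _) k<ℓ)
... | no undominated = irreducible-connected G bridge clustered valid k<ℓ irr
  where
  irr : Irreducible G
  irr {u} {v} u≢v =
    let w , ¬uw→vw = ¬∀⟶∃¬ _ _ (λ w → adj? G u w →-dec adj? G v w)
                       (λ N⊆ → undominated (u , v , u≢v , N⊆))
    in w , decidable-stable (adj? G u w) (λ u≁w → ¬uw→vw λ uw → contradiction uw u≁w)
         , λ vw → ¬uw→vw λ _ → vw

-- Walks and diameter

walkLength-◅◅ : (G : Graph V) {u v w : V} (p : Walk G u v) (q : Walk G v w) →
                walkLength G (p ◅◅ q) ≡ walkLength G p + walkLength G q
walkLength-◅◅ G ε       q = refl
walkLength-◅◅ G (_ ◅ p) q = cong suc (walkLength-◅◅ G p q)

ShortWalk : (G : Graph V) → V → V → ℕ → Set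
ShortWalk G u v m = Σ (Walk G u v) λ w → walkLength G w ≤ m

module _ {G : Graph (Fin n)} where

  valid : (c : Coloring G ℓ) → Valid G (color c)
  valid (coloring xs proper) = recompute (proper? G xs) proper

  coloring-ext : (c d : Coloring G ℓ) → color c ≗ color d → c ≡ d
  coloring-ext (coloring xs _) (coloring ys _) eq
    with trans (sym (tabulate∘lookup xs)) (trans (tabulate-cong eq) (tabulate∘lookup ys))
  ... | refl = refl

  module _ {d : Coloring G ℓ} where

    -- `L` holds the vertices that may still differ. The jump condition survives a step: the
    -- recoloured vertex already has its colour in `d`, and `d` is proper.
    recolour-along : ∀ L {c : Coloring G ℓ} → Jump G (color c) (color d) →
      (∀ v → color c v ≡ color d v ⊎ v ∈ L) → ShortWalk (R ℓ G) c d (length L)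
    recolour-along [] {c} j rest with coloring-ext c d (λ v → [ id , (λ ()) ]′ (rest v))
    ... | refl = ε , z≤n
    recolour-along (v ∷ L) {c} j rest with color c v ≟ color d v
    ... | yes same =
      let w , short = recolour-along L j λ u → case rest u of λ where
            (inj₁ eq)          → inj₁ eq
            (inj₂ (here refl)) → inj₁ same
            (inj₂ (there u∈L)) → inj₂ u∈L
      in w , ℕ.m≤n⇒m≤1+n short
    ... | no differ =
      let w , short = recolour-along L {c′} j′ λ u → case rest u of λ where
            (inj₂ (here refl)) → inj₁ at-v
            (inj₂ (there u∈L)) → inj₂ u∈L
            (inj₁ eq)          → case u ≟ v of λ where
              (yes refl) → contradiction eq differ
              (no u≢v)   → inj₁ (trans (off-v u≢v) eq)
      in (v , (λ eq → differ (trans eq at-v)) , λ u u≢v → sym (off-v u≢v)) ◅ w , s≤s short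
      where
      ys : Vec (Fin ℓ) n
      ys = colors c [ v ]≔ color d v

      at-v : lookup ys v ≡ color d v
      at-v = lookup∘update v (colors c) (color d v)

      off-v : ∀ {u} → u ≢ v → lookup ys u ≡ color c u
      off-v u≢v = lookup∘update′ u≢v (colors c) (color d v)

      proper′ : Proper G ys
      proper′ u w uw eq with u ≟ v | w ≟ v
      ... | yes refl | yes refl = adj-irrefl G v uw
      ... | yes refl | no w≢v   = j w v (adj-sym G uw) (trans (sym (off-v w≢v)) (trans (sym eq) at-v))
      ... | no u≢v   | yes refl = j u v uw (trans (sym (off-v u≢v)) (trans eq at-v))
      ... | no u≢v   | no w≢v   = valid c u w uw (trans (sym (off-v u≢v)) (trans eq (off-v w≢v)))

      c′ : Coloring G ℓ
      c′ = coloring ys proper′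

      j′ : Jump G (color c′) (color d)
      j′ u w uw eq with u ≟ v
      ... | yes refl = valid d v w uw (trans (sym at-v) eq)
      ... | no u≢v   = j u w uw (trans (sym (off-v u≢v)) eq)

    jump-walk : {c : Coloring G ℓ} → Jump G (color c) (color d) → ShortWalk (R ℓ G) c d n
    jump-walk j =
      let w , short = recolour-along (List.allFin n) j λ v → inj₂ (∈-allFin v)
      in w , ℕ.≤-trans short (ℕ.≤-reflexive (length-tabulate (id {A = Fin n})))

  chain-walk : {c d : Coloring G ℓ} {f g : Fin n → Fin ℓ} → color c ≗ f → color d ≗ g →
               Chain G m f g → ShortWalk (R ℓ G) c d (m * n)
  chain-walk {c = c} {d} c≗f d≗g (stop f≗g)
    with coloring-ext c d (λ v → trans (c≗f v) (trans (f≗g v) (sym (d≗g v))))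
  ... | refl = ε , z≤n
  chain-walk {ℓ = ℓ} {c = c} c≗f d≗g (step {d = h} j valid-h p) =
    let w₁ , short₁ = jump-walk {d = c′} j′
        w₂ , short₂ = chain-walk (lookup∘tabulate h) d≗g p
    in w₁ ◅◅ w₂ , ℕ.≤-trans (ℕ.≤-reflexive (walkLength-◅◅ (R ℓ G) w₁ w₂)) (ℕ.+-mono-≤ short₁ short₂)
    where
    c′ : Coloring G ℓ
    c′ = coloring (tabulate h) λ u v uv eq →
      valid-h u v uv (trans (sym (lookup∘tabulate h u)) (trans eq (lookup∘tabulate h v)))

    j′ : Jump G (color c) (color c′)
    j′ u v uv eq = j u v uv (trans (sym (c≗f u)) (trans eq (lookup∘tabulate h v)))

-- Existence of the diameter

Searchable : Set → Set₁
Searchable V = ∀ {P : V → Set} → U.Decidable P → Dec (∃ P)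

module _ (G : Graph V) (_≟ⱽ_ : DecidableEquality V) (search : Searchable V) where

  walk-of-length? : ∀ m u v → Dec (∃[ w ] walkLength G {u} {v} w ≡ m)
  walk-of-length? zero u v =
    map′ (λ { refl → ε , refl }) (λ { (ε , _) → refl ; (_ ◅ _ , ()) }) (u ≟ⱽ v)
  walk-of-length? (suc m) u v =
    map′ (λ { (_ , ux , w , refl) → ux ◅ w , refl })
         (λ { (ux ◅ w , refl) → _ , ux , w , refl ; (ε , ()) })
      (search λ x → adj? G u x ×-dec walk-of-length? m x v)

  -- `D` is the least common bound on the distances; were it attained by no pair, it could be
  -- lowered by one. The vertex `v₀` excludes the bound 0 in that argument.
  diameter : ∀ {B} → V → (∀ u v → ShortWalk G u v B) → ∃[ D ] (IsDiameter G D × D ≤ B)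
  diameter {B} v₀ short = D , (bounded , attained) , D-minimal B dist≤B
    where
    distance : ∀ u v → ∃ (IsDistance G u v)
    distance u v =
      let w , _ = short u v
          d , shortest , minimal = least (λ m → walk-of-length? m u v) (walkLength G w) (w , refl)
      in d , shortest , λ w′ → minimal (walkLength G w′) (w′ , refl)

    dist : V → V → ℕ
    dist u v = proj₁ (distance u v)

    dist≤B : ∀ u v → dist u v ≤ B
    dist≤B u v = let w , w≤B = short u v in ℕ.≤-trans (proj₂ (proj₂ (distance u v)) w) w≤B

    every : {P : V → Set} → U.Decidable P → Dec (∀ v → P v)
    every P? = map′ (λ none v → decidable-stable (P? v) λ ¬p → none (v , ¬p))
                    (λ all (v , ¬p) → ¬p (all v)) (¬? (search (¬? ∘ P?)))

    least-bound : ∃[ D ] (∀ u v → dist u v ≤ D) × (∀ D′ → (∀ u v → dist u v ≤ D′) → D ≤ D′)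
    least-bound = least (λ D → every λ u → every λ v → dist u v ℕ.≤? D) B dist≤B

    D = proj₁ least-bound
    dist≤D = proj₁ (proj₂ least-bound)
    D-minimal = proj₂ (proj₂ least-bound)

    bounded : ∀ u v → ∃[ d ] IsDistance G u v d × d ≤ D
    bounded u v = dist u v , proj₂ (distance u v) , dist≤D u v

    below : ∀ {D} → (∀ u v → dist u v < D) → ∃[ D′ ] D′ < D × (∀ u v → dist u v ≤ D′)
    below {zero}  dist<D = contradiction (dist<D v₀ v₀) λ ()
    below {suc D} dist<D = D , ℕ.≤-refl , λ u v → ℕ.≤-pred (dist<D u v)

    attained : ∃₂ λ u v → IsDistance G u v D
    attained with search (λ u → search λ v → dist u v ℕ.≟ D)
    ... | yes (u , v , eq) = u , v , subst (IsDistance G u v) eq (proj₂ (distance u v))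
    ... | no unattained =
      let D′ , D′<D , dist≤D′ = below λ u v →
            ℕ.≤∧≢⇒< (dist≤D u v) λ eq → unattained (u , v , eq)
      in contradiction (D-minimal D′ dist≤D′) (ℕ.<⇒≱ D′<D)

coloring-≟ : {G : Graph (Fin n)} → DecidableEquality (Coloring G ℓ)
coloring-≟ (coloring xs _) (coloring ys _) =
  map′ (λ { refl → refl }) (λ { refl → refl }) (≡-dec _≟_ xs ys)

coloring-search : {G : Graph (Fin n)} → Searchable (Coloring G ℓ)
coloring-search {n} {G = G} {P} P? =
  map′ (λ (xs , p , q) → coloring xs p , q)
       (λ (c , q) → colors c , valid c , q)
       (anyVec? n λ xs → proper-and xs (proper? G xs))
  where
  proper-and : ∀ xs → Dec (Proper G xs) → Dec (Σ (Proper G xs) λ p → P (coloring xs p))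
  proper-and xs (yes p) = map′ (p ,_) proj₂ (P? (coloring xs p))
  proper-and xs (no ¬p) = no (¬p ∘ proj₁)

module _ (G : Graph (Fin n)) (free : Free 2K₂ diamond G) (χ<ℓ : χ G + 1 ≤ ℓ) where
  private
    χ-coloring : Coloring G (χ G)
    χ-coloring = proj₁ (χ-isChromaticNumber G)

    χ<ℓ′ : χ G < ℓ
    χ<ℓ′ = subst (_≤ ℓ) (ℕ.+-comm (χ G) 1) χ<ℓ

  short-walks : ∀ c d → ShortWalk (R ℓ G) c d (n * 2 * n)
  short-walks c d = chain-walk (λ _ → refl) (λ _ → refl)
    (jump-connected G (2K₂-free⇒bridged G (proj₁ free)) (diamond-free⇒clustered G (proj₂ free))
      (valid χ-coloring) χ<ℓ′ (valid c) (valid d))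

  some-coloring : Coloring G ℓ
  some-coloring = coloring (tabulate f) λ u v uv eq →
    valid χ-coloring u v uv (inject≤-injective χ≤ℓ χ≤ℓ _ _
      (trans (sym (lookup∘tabulate f u)) (trans eq (lookup∘tabulate f v))))
    where
    χ≤ℓ = ℕ.<⇒≤ χ<ℓ′
    f : Fin n → Fin ℓ
    f v = inject≤ (color χ-coloring v) χ≤ℓ

theorem12 : ∀ (n : ℕ) (G : Graph (Fin n)) → Free 2K₂ diamond G →
    Recolorable G × (∀ ℓ → χ G + 1 ≤ ℓ → ∃[ D ] (IsDiameter (R ℓ G) D × D ≤ 2 * n ^ 2))
theorem12 n G free =
  (λ ℓ χ<ℓ c d → proj₁ (short-walks G free χ<ℓ c d)) ,
  (λ ℓ χ<ℓ → subst (λ B → ∃[ D ] (IsDiameter (R ℓ G) D × D ≤ B)) bound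
    (diameter (R ℓ G) coloring-≟ coloring-search (some-coloring G free χ<ℓ) (short-walks G free χ<ℓ)))
  where
  bound : n * 2 * n ≡ 2 * n ^ 2
  bound = begin
    n * 2 * n    ≡⟨ cong (_* n) (ℕ.*-comm n 2) ⟩
    2 * n * n    ≡⟨ ℕ.*-assoc 2 n n ⟩
    2 * (n * n)  ≡⟨ cong (λ x → 2 * (n * x)) (ℕ.*-identityʳ n) ⟨
    2 * n ^ 2    ∎
    where open ≡-Reasoning
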